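{- Let $\Sigma=\{0,1,2,3\}$. There are exactly $2^{27}$ unitrades in $\Sigma^3$; they fall into exactly $2528$ equivalence classes, and exactly $312$ of these equivalence classes have representatives that are equivalent to their complements in $\Sigma^3$.
   Context: Let $\Sigma=\{0,1,2,3\}$. A line in $\Sigma^n$ is a set of $4$ words that agree in all coordinates but one. A set $S\subseteq\Sigma^n$ is a unitrade if every line contains an even number of elements of $S$. An isotopy is an $n$-tuple $\bar\theta=(\theta_1,\dots,\theta_n)$ of permutations of $\Sigma$, acting by $\bar\theta S=\{(\theta_1x_1,\dots,\theta_nx_n):x\in S\}$. Two sets $S_1,S_2\subseteq\Sigma^n$ are equivalent if $\sigma\bar\theta S_1=S_2$ for some isotopy $\bar\theta$ and some permutation $\sigma$ of the $n$ coordinates. -}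

module Defs where

open import Data.Bool using (Bool; true; false; not)
open import Data.Nat using (ℕ; _+_)
open import Data.Nat.Divisibility using (_∣_)
open import Data.Fin using (Fin; zero; suc; _≟_)
open import Relation.Nullary using (yes; no)
open import Relation.Binary.PropositionalEquality using (_≡_)
open import Data.Fin.Permutation using (Permutation′; _⟨$⟩ʳ_; _⟨$⟩ˡ_)
open import Data.Vec using (Vec; lookup; map)
open import Data.Product using (Σ; ∃; _×_)

Sym : Set
Sym = Fin 4

Word : Set
Word = Fin 3 → Sym

Subset3 : Set
Subset3 = Vec (Vec (Vec Bool 4) 4) 4

_∈₃_ : Word → Subset3 → Bool
w ∈₃ S = lookup (lookup (lookup S (w zero)) (w (suc zero))) (w (suc (suc zero)))

complement : Subset3 → Subset3
complement = map (map (map not))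

count : (Sym → Bool) → ℕ
count f = b (f zero) + b (f (suc zero)) + b (f (suc (suc zero))) + b (f (suc (suc (suc zero))))
  where
  b : Bool → ℕ
  b true = 1
  b false = 0

update : Word → Fin 3 → Sym → Word
update w j a i with i ≟ j
... | yes _ = a
... | no _ = w i

IsUnitrade : Subset3 → Set
IsUnitrade S = ∀ (w : Word) (j : Fin 3) → 2 ∣ count (λ a → update w j a ∈₃ S)

-- isotopy θ̄ followed by coordinate permutation σ, acting on words:
-- (θ̄ x)_i = θ_i (x_i),   (σ y)_i = y_{σ⁻¹ i}
act : Permutation′ 3 → (Fin 3 → Permutation′ 4) → Word → Word
act σ θ x i = θ (σ ⟨$⟩ˡ i) ⟨$⟩ʳ x (σ ⟨$⟩ˡ i)

-- S₁ ~ S₂ iff σ θ̄ S₁ = S₂ for some σ, θ̄. Since act σ θ is a bijection of Σ^3,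
-- σ θ̄ S₁ = S₂ is equivalent to: for all x, (act σ θ x ∈ S₂) = (x ∈ S₁).
Equivalent : Subset3 → Subset3 → Set
Equivalent S₁ S₂ = Σ (Permutation′ 3) λ σ → Σ (Fin 3 → Permutation′ 4) λ θ →
  ∀ (x : Word) → (act σ θ x ∈₃ S₂) ≡ (x ∈₃ S₁)

{-# OPTIONS --safe #-}
-- Count orbits with the Cauchy–Frobenius lemma.  For a group G acting on a set X and an involution c of X
-- commuting with G, the sum over g ∈ G of |{x : x·g = c x}| is |G| times the number of orbits that c maps to
-- themselves; c = id counts all orbits, and c = complement the self-complementary ones.
-- Here G = S₄ ≀ S₃ has order 82944, and for each g the unitrades with S·g = c S are the solutions of a linear
-- system over GF(2) in the 64 cells of the cube, whose number is found by Gaussian elimination.  That number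
-- depends only on the conjugacy class of g: over σ = id it depends on the cycle types of the three θᵢ, over
-- a transposition on those of a product of two θᵢ and of the third one, over a 3-cycle on that of the product
-- of all three θᵢ.
module Submission where

open import Defs
open import Data.Nat using (ℕ; _^_)
open import Data.List using (List; _++_; length)
open import Data.List.Relation.Unary.All using (All)
open import Data.List.Relation.Unary.Any using (Any)
open import Data.List.Relation.Unary.Unique.Propositional using (Unique)
open import Data.List.Relation.Unary.AllPairs using (AllPairs)
open import Data.List.Membership.Propositional using (_∈_)
open import Data.Product using (Σ; _×_)
open import Relation.Nullary using (¬_)
open import Relation.Binary.PropositionalEquality using (_≡_)

open import Algebra.Bundles using (CommutativeRing)
open import Data.Bool using (Bool; true; false; if_then_else_; _xor_; not)
import Data.Bool as Bool
open import Data.Bool.Properties using (xor-∧-commutativeRing; xor-assoc; xor-comm; xor-same; xor-identityʳ; not-involutive)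
open import Data.Fin using (Fin; zero; suc; _≟_; #_; combine; remQuot)
open import Data.Fin.Patterns using (0F; 1F; 2F; 3F; 4F; 5F)
open import Data.Fin.Properties using (all?; any?; combine-remQuot; remQuot-combine)
import Data.Fin.Permutation as Perm
open import Data.Fin.Permutation using (Permutation′; permutation; _⟨$⟩ʳ_; _⟨$⟩ˡ_; inverseˡ; inverseʳ; _∘ₚ_; flip; _≈_)
open import Data.List using ([]; _∷_; map; filter; cartesianProduct; allFin; deduplicate)
open import Data.List.Properties using (length-++; length-map; length-tabulate)
import Data.List.Relation.Unary.All as All
open import Data.List.Relation.Unary.All using ([]; _∷_)
import Data.List.Relation.Unary.All.Properties as Allₚ
import Data.List.Relation.Unary.Any as Any
open import Data.List.Relation.Unary.Any using (here; there)
import Data.List.Relation.Unary.Any.Properties as Anyₚ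
open import Data.List.Relation.Unary.AllPairs using ([]; _∷_)
import Data.List.Relation.Unary.AllPairs.Properties as AllPairsₚ
import Data.List.Relation.Unary.Unique.DecSetoid.Properties as DecUniqueₚ
import Data.List.Relation.Unary.Unique.Propositional.Properties as Uniqueₚ
open import Data.List.Membership.Propositional using (find; lose)
open import Data.List.Membership.Propositional.Properties using (∈-allFin; ∈-cartesianProduct⁺; ∈-filter⁺; ∈-filter⁻; ∈-map⁺; ∈-map⁻; ∈-++⁺ˡ; ∈-++⁺ʳ)
open import Data.Nat using (zero; suc; _+_; _*_)
open import Data.Nat.Divisibility using (_∣_; divides)
open import Data.Nat.Properties using (+-assoc; +-identityʳ; *-comm; *-identityˡ; *-identityʳ; *-zeroʳ; *-distribˡ-+; *-cancelˡ-≡; suc-injective; +-commutativeSemigroup)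
open import Data.Product using (∃; _,_; proj₁; proj₂)
open import Data.Sum using (_⊎_; inj₁; inj₂)
open import Data.Unit using (⊤; tt)
import Data.Vec as Vec
open import Data.Vec using (Vec; []; _∷_; lookup; replicate; tabulate; zipWith)
open import Data.Vec.Properties using (lookup∘tabulate; tabulate∘lookup; tabulate-cong; lookup-map; ≡-dec; ∷-injectiveʳ)
open import Function using (_∘_)
open import Level using (0ℓ)
open import Relation.Binary using (Rel; Decidable; DecidableEquality; DecSetoid; IsEquivalence)
open import Relation.Binary.PropositionalEquality using (_≢_; _≗_; refl; sym; trans; cong; cong₂; subst; module ≡-Reasoning)
open import Relation.Nullary using (Dec; yes; no; does; contradiction; ¬?; _×-dec_; _⊎-dec_; _→-dec_)
open import Relation.Nullary.Decidable using (from-yes; map′)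
import Relation.Unary as Unary
open import Algebra.Properties.CommutativeSemigroup +-commutativeSemigroup using (interchange)
open import Algebra.Properties.CommutativeSemigroup (CommutativeRing.+-commutativeSemigroup xor-∧-commutativeRing) using () renaming (interchange to xor-interchange)

-- Finite sums

-- The lists of 2^27 unitrades and of 82944 group elements must never be unfolded by the type
-- checker. Both sit behind `abstract` interfaces that expose facts such as membership and a rule
-- for sums, and what is evaluated are closed numbers `#solutions 64 es`: besides the count of all
-- unitrades, 125 triples of cycle types over the identity, 25 pairs over (01) and 5 types over
-- (012), each with and without complementation. The dependence on products of the θᵢ comes from
-- conjugating by an isotopy h: the entry θⱼ becomes h(σj)⁻¹ θⱼ hⱼ, so along a cycle of σ every
-- entry but the last can be made the identity, and the last becomes the product around the cycle,
-- up to conjugacy. In the sum over the group a cycle of length l then yields a factor 24^(l-1), the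
-- number of ways to choose the other entries. Complementation enters the linear system only through
-- constant terms, so one Boolean `c` carries both counts through the whole argument.

⟦_⟧ : {P : Set} → Dec P → ℕ
⟦ P? ⟧ = if does P? then 1 else 0

⟦⟧-yes : {P : Set} (P? : Dec P) → P → ⟦ P? ⟧ ≡ 1
⟦⟧-yes (yes _) p = refl
⟦⟧-yes (no ¬p) p = contradiction p ¬p

⟦⟧-no : {P : Set} (P? : Dec P) → ¬ P → ⟦ P? ⟧ ≡ 0
⟦⟧-no (yes p) ¬p = contradiction p ¬p
⟦⟧-no (no _)  ¬p = refl

⟦⟧-cong : {P Q : Set} (P? : Dec P) (Q? : Dec Q) → (P → Q) → (Q → P) → ⟦ P? ⟧ ≡ ⟦ Q? ⟧
⟦⟧-cong (yes p) Q? f g = sym (⟦⟧-yes Q? (f p))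
⟦⟧-cong (no ¬p) Q? f g = sym (⟦⟧-no Q? (¬p ∘ g))

⟦⟧-× : {P Q : Set} (P? : Dec P) (Q? : Dec Q) → ⟦ P? ⟧ * ⟦ Q? ⟧ ≡ ⟦ P? ×-dec Q? ⟧
⟦⟧-× (yes _) Q? = *-identityˡ ⟦ Q? ⟧
⟦⟧-× (no _)  Q? = refl

⟦⟧-¬ : {P : Set} (P? : Dec P) → ⟦ P? ⟧ + ⟦ ¬? P? ⟧ ≡ 1
⟦⟧-¬ (yes _) = refl
⟦⟧-¬ (no _)  = refl

∑ : {A : Set} → List A → (A → ℕ) → ℕ
∑ []       f = 0
∑ (x ∷ xs) f = f x + ∑ xs f

module _ {A : Set} where

  ∑-cong-∈ : ∀ (xs : List A) {f g : A → ℕ} → (∀ {x} → x ∈ xs → f x ≡ g x) → ∑ xs f ≡ ∑ xs g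
  ∑-cong-∈ []       eq = refl
  ∑-cong-∈ (x ∷ xs) eq = cong₂ _+_ (eq (here refl)) (∑-cong-∈ xs (eq ∘ there))

  ∑-cong : ∀ (xs : List A) {f g : A → ℕ} → (∀ x → f x ≡ g x) → ∑ xs f ≡ ∑ xs g
  ∑-cong xs eq = ∑-cong-∈ xs (λ {x} _ → eq x)

  ∑-const : ∀ (xs : List A) c → ∑ xs (λ _ → c) ≡ length xs * c
  ∑-const []       c = refl
  ∑-const (x ∷ xs) c = cong (c +_) (∑-const xs c)

  ∑-zero : ∀ (xs : List A) {f : A → ℕ} → (∀ {x} → x ∈ xs → f x ≡ 0) → ∑ xs f ≡ 0
  ∑-zero xs eq = trans (∑-cong-∈ xs eq) (trans (∑-const xs 0) (*-zeroʳ (length xs)))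

  ∑-+ : ∀ (xs : List A) (f g : A → ℕ) → ∑ xs (λ x → f x + g x) ≡ ∑ xs f + ∑ xs g
  ∑-+ []       f g = refl
  ∑-+ (x ∷ xs) f g = trans (cong (f x + g x +_) (∑-+ xs f g)) (interchange (f x) (g x) (∑ xs f) (∑ xs g))

  ∑-*ˡ : ∀ (xs : List A) c (f : A → ℕ) → ∑ xs (λ x → c * f x) ≡ c * ∑ xs f
  ∑-*ˡ []       c f = sym (*-zeroʳ c)
  ∑-*ˡ (x ∷ xs) c f = trans (cong (c * f x +_) (∑-*ˡ xs c f)) (sym (*-distribˡ-+ c (f x) (∑ xs f)))

  ∑-*ʳ : ∀ (xs : List A) (f : A → ℕ) c → ∑ xs (λ x → f x * c) ≡ ∑ xs f * c
  ∑-*ʳ xs f c = trans (∑-cong xs (λ x → *-comm (f x) c)) (trans (∑-*ˡ xs c f) (*-comm c (∑ xs f)))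

  ∑-++ : ∀ (xs ys : List A) (f : A → ℕ) → ∑ (xs ++ ys) f ≡ ∑ xs f + ∑ ys f
  ∑-++ []       ys f = refl
  ∑-++ (x ∷ xs) ys f = trans (cong (f x +_) (∑-++ xs ys f)) (sym (+-assoc (f x) (∑ xs f) (∑ ys f)))

  ∑-filter : {P : Unary.Pred A 0ℓ} (P? : Unary.Decidable P) (xs : List A) (f : A → ℕ) →
             ∑ (filter P? xs) f ≡ ∑ xs (λ x → ⟦ P? x ⟧ * f x)
  ∑-filter P? []       f = refl
  ∑-filter P? (x ∷ xs) f with does (P? x)
  ... | true  = cong₂ _+_ (sym (*-identityˡ (f x))) (∑-filter P? xs f)
  ... | false = ∑-filter P? xs f

  length-filter : {P : Unary.Pred A 0ℓ} (P? : Unary.Decidable P) (xs : List A) →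
                  length (filter P? xs) ≡ ∑ xs (λ x → ⟦ P? x ⟧)
  length-filter P? []       = refl
  length-filter P? (x ∷ xs) with does (P? x)
  ... | true  = cong suc (length-filter P? xs)
  ... | false = length-filter P? xs

  ∑-single : ∀ {xs : List A} {y} (f : A → ℕ) → Unique xs → y ∈ xs →
             (∀ {x} → x ∈ xs → x ≢ y → f x ≡ 0) → ∑ xs f ≡ f y
  ∑-single {x ∷ xs} f (x∉xs ∷ _) (here refl) zeros =
    trans (cong (f x +_) (∑-zero xs (λ z∈xs → zeros (there z∈xs) (All.lookup x∉xs z∈xs ∘ sym)))) (+-identityʳ (f x))
  ∑-single {x ∷ xs} f (x∉xs ∷ xs!) (there y∈xs) zeros =
    cong₂ _+_ (zeros (here refl) (All.lookup x∉xs y∈xs)) (∑-single f xs! y∈xs (zeros ∘ there))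

∑-map : {A B : Set} (h : A → B) (xs : List A) (f : B → ℕ) → ∑ (map h xs) f ≡ ∑ xs (f ∘ h)
∑-map h []       f = refl
∑-map h (x ∷ xs) f = cong (f (h x) +_) (∑-map h xs f)

∑-swap : {A B : Set} (xs : List A) (ys : List B) (f : A → B → ℕ) →
         ∑ xs (λ x → ∑ ys (f x)) ≡ ∑ ys (λ y → ∑ xs (λ x → f x y))
∑-swap []       ys f = sym (∑-zero ys (λ _ → refl))
∑-swap (x ∷ xs) ys f = trans (cong (∑ ys (f x) +_) (∑-swap xs ys f)) (sym (∑-+ ys (f x) _))

∑-cartesianProduct : {A B : Set} (xs : List A) (ys : List B) (f : A × B → ℕ) →
                     ∑ (cartesianProduct xs ys) f ≡ ∑ xs (λ x → ∑ ys (λ y → f (x , y)))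
∑-cartesianProduct []       ys f = refl
∑-cartesianProduct (x ∷ xs) ys f =
  trans (∑-++ (map (x ,_) ys) _ f) (cong₂ _+_ (∑-map (x ,_) ys f) (∑-cartesianProduct xs ys f))

length-cartesianProduct : {A B : Set} (xs : List A) (ys : List B) →
                          length (cartesianProduct xs ys) ≡ length xs * length ys
length-cartesianProduct []       ys = refl
length-cartesianProduct (x ∷ xs) ys =
  trans (length-++ (map (x ,_) ys)) (cong₂ _+_ (length-map (x ,_) ys) (length-cartesianProduct xs ys))

-- The list is bundled with the facts wanted of it, so that an `abstract` instance can hide the list
-- itself.
enumeration⁴ : {A B C D : Set} (ws : List A) (xs : List B) (ys : List C) (zs : List D) →
  Σ (List (A × B × C × D)) λ gs →
    (∀ {w x y z} → w ∈ ws → x ∈ xs → y ∈ ys → z ∈ zs → (w , x , y , z) ∈ gs)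
    × (∀ f → ∑ gs f ≡ ∑ ws λ w → ∑ xs λ x → ∑ ys λ y → ∑ zs λ z → f (w , x , y , z))
    × length gs ≡ length ws * (length xs * (length ys * length zs))
enumeration⁴ ws xs ys zs =
  cartesianProduct ws (cartesianProduct xs (cartesianProduct ys zs)) ,
  (λ w∈ x∈ y∈ z∈ → ∈-cartesianProduct⁺ w∈ (∈-cartesianProduct⁺ x∈ (∈-cartesianProduct⁺ y∈ z∈))) ,
  (λ f → trans (∑-cartesianProduct ws _ f)
    (∑-cong ws λ w → trans (∑-cartesianProduct xs _ (λ h → f (w , h)))
    (∑-cong xs λ x → ∑-cartesianProduct ys zs (λ h → f (w , x , h))))) ,
  trans (length-cartesianProduct ws _) (cong (length ws *_)
    (trans (length-cartesianProduct xs _) (cong (length xs *_) (length-cartesianProduct ys zs))))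

-- Both sides are obtained by summing F over the graph {(x , y) : f x = y}.
∑-fibres : {A B : Set} (_≟_ : DecidableEquality B) (xs : List A) {ys : List B} → Unique ys →
           (f : A → B) → (∀ {x} → x ∈ xs → f x ∈ ys) → (F : B → ℕ) →
           ∑ xs (F ∘ f) ≡ ∑ ys (λ y → ∑ xs (λ x → ⟦ f x ≟ y ⟧) * F y)
∑-fibres _≟_ xs {ys} ys! f f∈ F = begin
  ∑ xs (F ∘ f)
    ≡⟨ ∑-cong-∈ xs (λ {x} x∈ → trans (sym (one x))
         (sym (∑-single _ ys! (f∈ x∈) (λ {y} _ y≢fx → off x y (y≢fx ∘ sym))))) ⟩
  ∑ xs (λ x → ∑ ys (λ y → ⟦ f x ≟ y ⟧ * F y))
    ≡⟨ ∑-swap xs ys _ ⟩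
  ∑ ys (λ y → ∑ xs (λ x → ⟦ f x ≟ y ⟧ * F y))
    ≡⟨ ∑-cong ys (λ y → ∑-*ʳ xs _ (F y)) ⟩
  ∑ ys (λ y → ∑ xs (λ x → ⟦ f x ≟ y ⟧) * F y) ∎
  where
  open ≡-Reasoning
  one : ∀ x → ⟦ f x ≟ f x ⟧ * F (f x) ≡ F (f x)
  one x = trans (cong (_* F (f x)) (⟦⟧-yes (f x ≟ f x) refl)) (*-identityˡ _)
  off : ∀ x y → f x ≢ y → ⟦ f x ≟ y ⟧ * F y ≡ 0
  off x y fx≢y = cong (_* F y) (⟦⟧-no (f x ≟ y) fx≢y)

∑-reindex : {A : Set} (_≟_ : DecidableEquality A) {xs : List A} → Unique xs → (f f⁻¹ : A → A) →
            (∀ x → f⁻¹ (f x) ≡ x) → (∀ x → f (f⁻¹ x) ≡ x) →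
            (∀ {x} → x ∈ xs → f x ∈ xs) → (∀ {x} → x ∈ xs → f⁻¹ x ∈ xs) →
            (F : A → ℕ) → ∑ xs (F ∘ f) ≡ ∑ xs F
∑-reindex _≟_ {xs} xs! f f⁻¹ invˡ invʳ f∈ f⁻¹∈ F =
  trans (∑-fibres _≟_ xs xs! f f∈ F) (∑-cong-∈ xs (λ {y} y∈ → trans (cong (_* F y) (fibre y∈)) (*-identityˡ (F y))))
  where
  fibre : ∀ {y} → y ∈ xs → ∑ xs (λ x → ⟦ f x ≟ y ⟧) ≡ 1
  fibre {y} y∈ = trans
    (∑-single _ xs! (f⁻¹∈ y∈) (λ {x} _ x≢ → ⟦⟧-no (f x ≟ y) (λ fx≡y → x≢ (trans (sym (invˡ x)) (cong f⁻¹ fx≡y)))))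
    (⟦⟧-yes (f (f⁻¹ y) ≟ y) (invʳ y))

-- Orbit counting

-- Translation invariance of sums over a group enters as `transporters`: the number of g carrying x
-- to z is the same for all x in one class.
module Burnside
  {X G : Set} (_≟_ : DecidableEquality X) {xs : List X} (xs! : Unique xs) (gs : List G) (_·_ : X → G → X)
  {_~_ : Rel X 0ℓ} (_~?_ : Decidable _~_) (~-isEquivalence : IsEquivalence _~_)
  (·-∈ : ∀ {x} g → x ∈ xs → (x · g) ∈ xs)
  (·-~ : ∀ x g → (x · g) ~ x)
  (transporters : ∀ {x y} → x ~ y → ∀ z → ∑ gs (λ g → ⟦ (x · g) ≟ z ⟧) ≡ ∑ gs (λ g → ⟦ (y · g) ≟ z ⟧))
  {R : List X} (R⊆xs : ∀ {r} → r ∈ R → r ∈ xs)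
  (R-separated : AllPairs (λ r s → ¬ (r ~ s)) R) (R-complete : ∀ {x} → x ∈ xs → Any (x ~_) R)
  where

  private module ~ = IsEquivalence ~-isEquivalence

  R-unique : Unique R
  R-unique = weaken R-separated
    where
    weaken : ∀ {rs} → AllPairs (λ r s → ¬ (r ~ s)) rs → Unique rs
    weaken []         = []
    weaken (≁r ∷ ≁rs) = All.map (λ { r≁s refl → r≁s ~.refl }) ≁r ∷ weaken ≁rs

  separated : ∀ {rs r s} → AllPairs (λ r s → ¬ (r ~ s)) rs → r ∈ rs → s ∈ rs → r ~ s → r ≡ s
  separated (≁r ∷ ≁rs) (here refl) (here refl) r~s = refl
  separated (≁r ∷ ≁rs) (here refl) (there s∈)  r~s = contradiction r~s (All.lookup ≁r s∈)
  separated (≁r ∷ ≁rs) (there r∈)  (here refl) r~s = contradiction (~.sym r~s) (All.lookup ≁r r∈)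
  separated (≁r ∷ ≁rs) (there r∈)  (there s∈)  r~s = separated ≁rs r∈ s∈ r~s

  ∑-representatives : ∀ {x} → x ∈ xs → ∑ R (λ r → ⟦ x ~? r ⟧) ≡ 1
  ∑-representatives {x} x∈ with find (R-complete x∈)
  ... | r , r∈ , x~r = trans
    (∑-single _ R-unique r∈
      (λ {s} s∈ s≢r → ⟦⟧-no (x ~? s) (λ x~s → s≢r (separated R-separated s∈ r∈ (~.trans (~.sym x~s) x~r)))))
    (⟦⟧-yes (x ~? r) x~r)

  -- For c = id this is the Cauchy–Frobenius lemma.
  twisted-burnside : (c : X → X) → (∀ x → c (c x) ≡ x) → (∀ {x} → x ∈ xs → c x ∈ xs) →
                     (∀ x g → c x · g ≡ c (x · g)) →
                     ∑ gs (λ g → ∑ xs (λ x → ⟦ (x · g) ≟ c x ⟧)) ≡ length gs * ∑ R (λ r → ⟦ r ~? c r ⟧)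
  twisted-burnside c c-involutive c∈ c-· = begin
    ∑ gs (λ g → ∑ xs (λ x → ⟦ (x · g) ≟ c x ⟧))
      ≡⟨ ∑-swap gs xs _ ⟩
    ∑ xs (λ x → ∑ gs (λ g → ⟦ (x · g) ≟ c x ⟧))
      ≡⟨ ∑-cong-∈ xs (λ x∈ → trans (sym (*-identityˡ _))
           (trans (cong (_* _) (sym (∑-representatives x∈))) (sym (∑-*ʳ R _ _)))) ⟩
    ∑ xs (λ x → ∑ R (λ r → ⟦ x ~? r ⟧ * ∑ gs (λ g → ⟦ (x · g) ≟ c x ⟧)))
      ≡⟨ ∑-cong xs (λ x → ∑-cong R (λ r → move x r)) ⟩
    ∑ xs (λ x → ∑ R (λ r → ∑ gs (λ g → ⟦ x ~? r ⟧ * ⟦ (r · g) ≟ c x ⟧)))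
      ≡⟨ ∑-swap xs R _ ⟩
    ∑ R (λ r → ∑ xs (λ x → ∑ gs (λ g → ⟦ x ~? r ⟧ * ⟦ (r · g) ≟ c x ⟧)))
      ≡⟨ ∑-cong R (λ r → ∑-swap xs gs _) ⟩
    ∑ R (λ r → ∑ gs (λ g → ∑ xs (λ x → ⟦ x ~? r ⟧ * ⟦ (r · g) ≟ c x ⟧)))
      ≡⟨ ∑-cong-∈ R (λ r∈ → ∑-cong gs (λ g → collapse g (R⊆xs r∈))) ⟩
    ∑ R (λ r → ∑ gs (λ g → ⟦ r ~? c r ⟧))
      ≡⟨ ∑-cong R (λ r → ∑-const gs _) ⟩
    ∑ R (λ r → length gs * ⟦ r ~? c r ⟧)
      ≡⟨ ∑-*ˡ R (length gs) _ ⟩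
    length gs * ∑ R (λ r → ⟦ r ~? c r ⟧) ∎
    where
    open ≡-Reasoning

    -- Equivalent elements have equally many transporters to `c x`, so x may be replaced by its
    -- representative on the left of the action.
    move : ∀ x r → ⟦ x ~? r ⟧ * ∑ gs (λ g → ⟦ (x · g) ≟ c x ⟧) ≡ ∑ gs (λ g → ⟦ x ~? r ⟧ * ⟦ (r · g) ≟ c x ⟧)
    move x r with x ~? r
    ... | yes x~r = trans (cong (1 *_) (transporters x~r (c x))) (sym (∑-*ˡ gs 1 _))
    ... | no  _   = sym (∑-zero gs (λ _ → refl))

    -- As c is an involution, only x = c (r · g) contributes. It lies in the class of c r because c
    -- commutes with the action, so it counts exactly when r ~ c r.
    collapse : ∀ {r} g → r ∈ xs → ∑ xs (λ x → ⟦ x ~? r ⟧ * ⟦ (r · g) ≟ c x ⟧) ≡ ⟦ r ~? c r ⟧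
    collapse {r} g r∈ = begin
      ∑ xs (λ x → ⟦ x ~? r ⟧ * ⟦ (r · g) ≟ c x ⟧)
        ≡⟨ ∑-single _ xs! (c∈ (·-∈ g r∈)) (λ {x} _ x≢ → trans (cong (⟦ x ~? r ⟧ *_)
             (⟦⟧-no ((r · g) ≟ c x) (λ rg≡cx → x≢ (trans (sym (c-involutive x)) (cong c (sym rg≡cx))))))
             (*-zeroʳ ⟦ x ~? r ⟧)) ⟩
      ⟦ c (r · g) ~? r ⟧ * ⟦ (r · g) ≟ c (c (r · g)) ⟧
        ≡⟨ cong (⟦ c (r · g) ~? r ⟧ *_) (⟦⟧-yes ((r · g) ≟ c (c (r · g))) (sym (c-involutive (r · g)))) ⟩
      ⟦ c (r · g) ~? r ⟧ * 1
        ≡⟨ trans (*-comm _ 1) (*-identityˡ _) ⟩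
      ⟦ c (r · g) ~? r ⟧
        ≡⟨ ⟦⟧-cong (c (r · g) ~? r) (r ~? c r)
             (λ p → ~.trans (~.sym p) c[rg]~cr) (λ p → ~.trans c[rg]~cr (~.sym p)) ⟩
      ⟦ r ~? c r ⟧ ∎
      where
      c[rg]~cr : c (r · g) ~ c r
      c[rg]~cr = subst (_~ c r) (c-· r g) (·-~ (c r) g)

-- Linear systems over GF(2)

Eqn : ℕ → Set
Eqn n = Vec Bool n × Bool

infixl 6 _⊕_
_⊕_ : ∀ {n} → Vec Bool n → Vec Bool n → Vec Bool n
_⊕_ = zipWith _xor_

unit : ∀ {n} → Fin n → Vec Bool n
unit zero    = true ∷ replicate _ false
unit (suc i) = false ∷ unit i

eval : ∀ {n} → Vec Bool n → Vec Bool n → Bool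
eval []          []      = false
eval (true ∷ f)  (x ∷ v) = x xor eval f v
eval (false ∷ f) (x ∷ v) = eval f v

eval-⊕ : ∀ {n} (f g v : Vec Bool n) → eval (f ⊕ g) v ≡ eval f v xor eval g v
eval-⊕ []          []          []      = refl
eval-⊕ (true ∷ f)  (true ∷ g)  (x ∷ v) =
  trans (eval-⊕ f g v) (trans (cong (_xor (eval f v xor eval g v)) (sym (xor-same x)))
    (xor-interchange x x (eval f v) (eval g v)))
eval-⊕ (true ∷ f)  (false ∷ g) (x ∷ v) = trans (cong (x xor_) (eval-⊕ f g v)) (sym (xor-assoc x _ _))
eval-⊕ (false ∷ f) (true ∷ g)  (x ∷ v) =
  trans (cong (x xor_) (eval-⊕ f g v)) (xor-interchange false x (eval f v) (eval g v))
eval-⊕ (false ∷ f) (false ∷ g) (x ∷ v) = eval-⊕ f g v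

eval-zero : ∀ {n} (v : Vec Bool n) → eval (replicate n false) v ≡ false
eval-zero []      = refl
eval-zero (x ∷ v) = eval-zero v

eval-unit : ∀ {n} (i : Fin n) (v : Vec Bool n) → eval (unit i) v ≡ lookup v i
eval-unit zero    (x ∷ v) = trans (cong (x xor_) (eval-zero v)) (xor-identityʳ x)
eval-unit (suc i) (x ∷ v) = eval-unit i v

Solves : ∀ {n} → Vec Bool n → Eqn n → Set
Solves v (f , b) = eval f v ≡ b

solves? : ∀ {n} (v : Vec Bool n) (e : Eqn n) → Dec (Solves v e)
solves? v (f , b) = eval f v Bool.≟ b

solvesAll? : ∀ {n} (v : Vec Bool n) (es : List (Eqn n)) → Dec (All (Solves v) es)
solvesAll? v = All.all? (solves? v)

allVec : ∀ n → List (Vec Bool n)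
allVec zero    = [] ∷ []
allVec (suc n) = map (false ∷_) (allVec n) ++ map (true ∷_) (allVec n)

∈-allVec : ∀ {n} (v : Vec Bool n) → v ∈ allVec n
∈-allVec []          = here refl
∈-allVec (false ∷ v) = ∈-++⁺ˡ (∈-map⁺ (false ∷_) (∈-allVec v))
∈-allVec (true ∷ v)  = ∈-++⁺ʳ _ (∈-map⁺ (true ∷_) (∈-allVec v))

allVec-unique : ∀ n → Unique (allVec n)
allVec-unique zero    = [] ∷ []
allVec-unique (suc n) = Uniqueₚ.++⁺
  (Uniqueₚ.map⁺ ∷-injectiveʳ (allVec-unique n)) (Uniqueₚ.map⁺ ∷-injectiveʳ (allVec-unique n)) disjoint
  where
  disjoint : ∀ {v} → ¬ (v ∈ map (false ∷_) (allVec n) × v ∈ map (true ∷_) (allVec n))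
  disjoint (p , q) with ∈-map⁻ (false ∷_) p | ∈-map⁻ (true ∷_) q
  ... | _ , _ , refl | _ , _ , ()

-- Adding the pivot equation `x xor eval p v ≡ c` cancels the leading variable x.
substitute : ∀ {n} → Eqn n → Eqn (suc n) → Eqn n
substitute (p , c) (true ∷ f , b)  = p ⊕ f , c xor b
substitute (p , c) (false ∷ f , b) = f , b

-- A count rather than a list of solutions, so that it reduces to a numeral without visiting the 2^n
-- vectors. Consistency is tested when no variable is left and each equation reads 0 = b.
#solutions : ∀ n → List (Eqn n) → ℕ
eliminate  : ∀ n → List (Eqn (suc n)) → List (Eqn n) → ℕ

#solutions zero    es = if does (solvesAll? [] es) then 1 else 0
#solutions (suc n) es = eliminate n es []

-- The second list holds the equations already seen to be free of the leading variable.
eliminate n []                      acc = 2 * #solutions n acc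
eliminate n ((true ∷ f , b) ∷ es)  acc = #solutions n (map (substitute (f , b)) es ++ acc)
eliminate n ((false ∷ f , b) ∷ es) acc = eliminate n es ((f , b) ∷ acc)

xor-cancelˡ : ∀ a {b c} → a xor b ≡ a xor c → b ≡ c
xor-cancelˡ false eq = eq
xor-cancelˡ true  {b} {c} eq = trans (sym (not-involutive b)) (trans (cong not eq) (not-involutive c))

module _ {n : ℕ} {p : Vec Bool n} {c : Bool} {v : Vec Bool n} {x : Bool} (pivot : x xor eval p v ≡ c) where

  xor-pivot : eval p v ≡ c xor x
  xor-pivot = trans (sym (xor-identityʳ _)) (trans (cong (eval p v xor_) (sym (xor-same x)))
    (trans (sym (xor-assoc (eval p v) x x)) (cong (_xor x) (trans (xor-comm (eval p v) x) pivot))))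

  substitute⁺ : ∀ e → Solves (x ∷ v) e → Solves v (substitute (p , c) e)
  substitute⁺ (false ∷ f , b) s = s
  substitute⁺ (true ∷ f , b)  s = begin
    eval (p ⊕ f) v           ≡⟨ eval-⊕ p f v ⟩
    eval p v xor eval f v    ≡⟨ cong (_xor eval f v) xor-pivot ⟩
    (c xor x) xor eval f v   ≡⟨ xor-assoc c x _ ⟩
    c xor (x xor eval f v)   ≡⟨ cong (c xor_) s ⟩
    c xor b                  ∎
    where open ≡-Reasoning

  substitute⁻ : ∀ e → Solves v (substitute (p , c) e) → Solves (x ∷ v) e
  substitute⁻ (false ∷ f , b) s = s
  substitute⁻ (true ∷ f , b)  s = xor-cancelˡ c (begin
    c xor (x xor eval f v)   ≡⟨ xor-assoc c x _ ⟨
    (c xor x) xor eval f v   ≡⟨ cong (_xor eval f v) xor-pivot ⟨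
    eval p v xor eval f v    ≡⟨ eval-⊕ p f v ⟨
    eval (p ⊕ f) v           ≡⟨ s ⟩
    c xor b                  ∎)
    where open ≡-Reasoning

∑-allVec-suc : ∀ n (F : Vec Bool (suc n) → ℕ) → ∑ (allVec (suc n)) F ≡ ∑ (allVec n) (λ v → F (false ∷ v) + F (true ∷ v))
∑-allVec-suc n F = begin
  ∑ (allVec (suc n)) F
    ≡⟨ ∑-++ (map (false ∷_) (allVec n)) _ F ⟩
  ∑ (map (false ∷_) (allVec n)) F + ∑ (map (true ∷_) (allVec n)) F
    ≡⟨ cong₂ _+_ (∑-map (false ∷_) (allVec n) F) (∑-map (true ∷_) (allVec n) F) ⟩
  ∑ (allVec n) (F ∘ (false ∷_)) + ∑ (allVec n) (F ∘ (true ∷_))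
    ≡⟨ ∑-+ (allVec n) _ _ ⟨
  ∑ (allVec n) (λ v → F (false ∷ v) + F (true ∷ v)) ∎
  where open ≡-Reasoning

-- Whatever the other variables are, exactly one value of the leading one satisfies the pivot
-- equation. Hence a pivot keeps the count, while a free variable doubles it.
pivot-value : ∀ a c → (false xor a ≡ c × true xor a ≢ c) ⊎ (true xor a ≡ c × false xor a ≢ c)
pivot-value true  true  = inj₁ (refl , λ ())
pivot-value true  false = inj₂ (refl , λ ())
pivot-value false true  = inj₂ (refl , λ ())
pivot-value false false = inj₁ (refl , λ ())

system? : ∀ {n} (es : List (Eqn (suc n))) (acc : List (Eqn n)) x v → Dec (All (Solves (x ∷ v)) es × All (Solves v) acc)
system? es acc x v = solvesAll? (x ∷ v) es ×-dec solvesAll? v acc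

#solutions-correct : ∀ n es → #solutions n es ≡ ∑ (allVec n) (λ v → ⟦ solvesAll? v es ⟧)
-- The two summands belong to the two values of the leading variable; `acc` is tested on v alone, so
-- they coincide once `es` is exhausted.
eliminate-correct : ∀ n es acc →
  eliminate n es acc ≡ ∑ (allVec n) (λ v → ⟦ system? es acc false v ⟧ + ⟦ system? es acc true v ⟧)

#solutions-correct zero    es = sym (+-identityʳ _)
#solutions-correct (suc n) es = trans (eliminate-correct n es []) (trans
  (∑-cong (allVec n) (λ v → cong₂ _+_ (drop false v) (drop true v)))
  (sym (∑-allVec-suc n _)))
  where
  drop : ∀ x v → ⟦ system? es [] x v ⟧ ≡ ⟦ solvesAll? (x ∷ v) es ⟧
  drop x v = ⟦⟧-cong (system? es [] x v) (solvesAll? (x ∷ v) es) proj₁ (λ s → s , [])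

eliminate-correct n [] acc = begin
  2 * #solutions n acc                                  ≡⟨ cong (2 *_) (#solutions-correct n acc) ⟩
  2 * ∑ (allVec n) (λ v → ⟦ solvesAll? v acc ⟧)         ≡⟨ ∑-*ˡ (allVec n) 2 _ ⟨
  ∑ (allVec n) (λ v → 2 * ⟦ solvesAll? v acc ⟧)
    ≡⟨ ∑-cong (allVec n) (λ v → cong₂ _+_ (add false v) (trans (+-identityʳ _) (add true v))) ⟩
  ∑ (allVec n) (λ v → ⟦ system? [] acc false v ⟧ + ⟦ system? [] acc true v ⟧) ∎
  where
  open ≡-Reasoning
  add : ∀ x v → ⟦ solvesAll? v acc ⟧ ≡ ⟦ system? [] acc x v ⟧
  add x v = ⟦⟧-cong (solvesAll? v acc) (system? [] acc x v) ([] ,_) proj₂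
eliminate-correct n ((false ∷ f , b) ∷ es) acc =
  trans (eliminate-correct n es ((f , b) ∷ acc)) (∑-cong (allVec n) (λ v → cong₂ _+_ (shift false v) (shift true v)))
  where
  shift : ∀ x v → ⟦ system? es ((f , b) ∷ acc) x v ⟧ ≡ ⟦ system? ((false ∷ f , b) ∷ es) acc x v ⟧
  shift x v = ⟦⟧-cong (system? es ((f , b) ∷ acc) x v) (system? ((false ∷ f , b) ∷ es) acc x v)
    (λ { (p , q ∷ r) → q ∷ p , r }) (λ { (q ∷ p , r) → p , q ∷ r })
eliminate-correct n ((true ∷ f , b) ∷ es) acc =
  trans (#solutions-correct n (map (substitute (f , b)) es ++ acc)) (∑-cong (allVec n) split)
  where
  system : List (Eqn (suc n))
  system = (true ∷ f , b) ∷ es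

  reduced? : ∀ v → Dec (All (Solves v) (map (substitute (f , b)) es ++ acc))
  reduced? v = solvesAll? v (map (substitute (f , b)) es ++ acc)

  solved : ∀ x v → x xor eval f v ≡ b → ⟦ reduced? v ⟧ ≡ ⟦ system? system acc x v ⟧
  solved x v eq = ⟦⟧-cong (reduced? v) (system? system acc x v)
    (λ s → let s₁ , s₂ = Allₚ.++⁻ _ s in
           eq ∷ All.map (λ {e} → substitute⁻ {p = f} {v = v} {x = x} eq e) (Allₚ.map⁻ s₁) , s₂)
    (λ { (_ ∷ s₁ , s₂) → Allₚ.++⁺ (Allₚ.map⁺ (All.map (λ {e} → substitute⁺ {p = f} {v = v} {x = x} eq e) s₁)) s₂ })

  unsolved : ∀ x v → x xor eval f v ≢ b → ⟦ system? system acc x v ⟧ ≡ 0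
  unsolved x v neq = ⟦⟧-no (system? system acc x v) (λ { (eq ∷ _ , _) → neq eq })

  split : ∀ v → ⟦ reduced? v ⟧ ≡ ⟦ system? system acc false v ⟧ + ⟦ system? system acc true v ⟧
  split v with pivot-value (eval f v) b
  ... | inj₁ (eq , neq) = trans (solved false v eq) (trans (sym (+-identityʳ _))
    (cong (⟦ system? system acc false v ⟧ +_) (sym (unsolved true v neq))))
  ... | inj₂ (eq , neq) = trans (solved true v eq) (cong (_+ ⟦ system? system acc true v ⟧) (sym (unsolved false v neq)))

-- The last component counts any subset of the solutions that is cut out by further equations `es′`;
-- through it later counts become eliminations and never traverse the list.
solution-enumeration : ∀ {n} {X : Set} (es : List (Eqn n)) (f : Vec Bool n → X) → (∀ {u v} → f u ≡ f v → u ≡ v) →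
  Σ (List X) λ L → Unique L
    × (∀ v → All (Solves v) es → f v ∈ L)
    × (∀ {x} → x ∈ L → ∃ λ v → All (Solves v) es × x ≡ f v)
    × (∀ {P : X → Set} (P? : ∀ x → Dec (P x)) es′ →
        (∀ v → All (Solves v) es′ → P (f v)) → (∀ v → P (f v) → All (Solves v) es′) →
        ∑ L (λ x → ⟦ P? x ⟧) ≡ #solutions n (es ++ es′))
solution-enumeration {n} {X} es f f-injective = L , L-unique , ∈-L⁺ , ∈-L⁻ , ∑-L
  where
  es? : ∀ v → Dec (All (Solves v) es)
  es? v = solvesAll? v es

  L : List X
  L = map f (filter es? (allVec n))

  L-unique : Unique L
  L-unique = Uniqueₚ.map⁺ f-injective (Uniqueₚ.filter⁺ es? (allVec-unique n))

  ∈-L⁺ : ∀ v → All (Solves v) es → f v ∈ L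
  ∈-L⁺ v solves = ∈-map⁺ f (∈-filter⁺ es? (∈-allVec v) solves)

  ∈-L⁻ : ∀ {x} → x ∈ L → ∃ λ v → All (Solves v) es × x ≡ f v
  ∈-L⁻ x∈ with ∈-map⁻ f x∈
  ... | v , v∈ , eq = v , proj₂ (∈-filter⁻ es? {xs = allVec n} v∈) , eq

  ∑-L : ∀ {P : X → Set} (P? : ∀ x → Dec (P x)) es′ →
        (∀ v → All (Solves v) es′ → P (f v)) → (∀ v → P (f v) → All (Solves v) es′) →
        ∑ L (λ x → ⟦ P? x ⟧) ≡ #solutions n (es ++ es′)
  ∑-L P? es′ sound complete = begin
    ∑ L (λ x → ⟦ P? x ⟧)
      ≡⟨ ∑-map f (filter es? (allVec n)) (λ x → ⟦ P? x ⟧) ⟩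
    ∑ (filter es? (allVec n)) (λ v → ⟦ P? (f v) ⟧)
      ≡⟨ ∑-filter es? (allVec n) (λ v → ⟦ P? (f v) ⟧) ⟩
    ∑ (allVec n) (λ v → ⟦ es? v ⟧ * ⟦ P? (f v) ⟧)
      ≡⟨ ∑-cong (allVec n) (λ v → trans (⟦⟧-× (es? v) (P? (f v)))
           (⟦⟧-cong (es? v ×-dec P? (f v)) (solvesAll? v (es ++ es′))
             (λ (s , p) → Allₚ.++⁺ s (complete v p))
             (λ s → let s₁ , s₂ = Allₚ.++⁻ es s in s₁ , sound v s₂))) ⟩
    ∑ (allVec n) (λ v → ⟦ solvesAll? v (es ++ es′) ⟧)
      ≡⟨ #solutions-correct n (es ++ es′) ⟨
    #solutions n (es ++ es′) ∎
    where open ≡-Reasoning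

-- The symmetric groups on three and four points

-- Permutations are coded as indices into a table: indices have decidable equality and can be summed
-- over, and the group laws follow from injectivity of `app`.
module PermutationTable
  {n m : ℕ} (app : Fin m → Fin n → Fin n) (_⁻¹ : Fin m → Fin m)
  (app-inverse : ∀ a x → app (a ⁻¹) (app a x) ≡ x × app a (app (a ⁻¹) x) ≡ x)
  (app-injective : ∀ a b → (∀ x → app a x ≡ app b x) → a ≡ b)
  (compose : ∀ a b → ∃ λ c → ∀ x → app c x ≡ app a (app b x))
  where

  infixr 7 _∙_
  _∙_ : Fin m → Fin m → Fin m
  a ∙ b = proj₁ (compose a b)

  app-∙ : ∀ a b x → app (a ∙ b) x ≡ app a (app b x)
  app-∙ a b = proj₂ (compose a b)

  perm : Fin m → Permutation′ n
  perm a = permutation (app a) (app (a ⁻¹)) (λ x → proj₂ (app-inverse a x)) (λ x → proj₁ (app-inverse a x))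

  ∙-cancelˡ : ∀ a b → a ⁻¹ ∙ (a ∙ b) ≡ b
  ∙-cancelˡ a b = app-injective _ _ λ x →
    trans (app-∙ (a ⁻¹) (a ∙ b) x) (trans (cong (app (a ⁻¹)) (app-∙ a b x)) (proj₁ (app-inverse a _)))

  ∙-cancelˡ′ : ∀ a b → a ∙ (a ⁻¹ ∙ b) ≡ b
  ∙-cancelˡ′ a b = app-injective _ _ λ x →
    trans (app-∙ a (a ⁻¹ ∙ b) x) (trans (cong (app a) (app-∙ (a ⁻¹) b x)) (proj₂ (app-inverse a _)))

  ∙-cancelʳ : ∀ a b → (b ∙ a) ∙ a ⁻¹ ≡ b
  ∙-cancelʳ a b = app-injective _ _ λ x →
    trans (app-∙ (b ∙ a) (a ⁻¹) x) (trans (app-∙ b a _) (cong (app b) (proj₂ (app-inverse a x))))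

  ∙-cancelʳ′ : ∀ a b → (b ∙ a ⁻¹) ∙ a ≡ b
  ∙-cancelʳ′ a b = app-injective _ _ λ x →
    trans (app-∙ (b ∙ a ⁻¹) a x) (trans (app-∙ b (a ⁻¹) _) (cong (app b) (proj₁ (app-inverse a x))))

  abstract
    -- Opaque, so that sums over the group stay symbolic; `elements-allFin` reopens the list where a
    -- sum is to be written out.
    elements : List (Fin m)
    elements = allFin m

    elements-allFin : elements ≡ allFin m
    elements-allFin = refl

    elements-unique : Unique elements
    elements-unique = Uniqueₚ.allFin⁺ m

    ∈-elements : ∀ a → a ∈ elements
    ∈-elements = ∈-allFin

    length-elements : length elements ≡ m
    length-elements = length-tabulate (λ a → a)

  ∑-∙ˡ : ∀ a (F : Fin m → ℕ) → ∑ elements (λ b → F (a ∙ b)) ≡ ∑ elements F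
  ∑-∙ˡ a = ∑-reindex _≟_ elements-unique (a ∙_) (a ⁻¹ ∙_) (∙-cancelˡ a) (∙-cancelˡ′ a) (λ _ → ∈-elements _) (λ _ → ∈-elements _)

  ∑-∙ʳ : ∀ a (F : Fin m → ℕ) → ∑ elements (λ b → F (b ∙ a)) ≡ ∑ elements F
  ∑-∙ʳ a = ∑-reindex _≟_ elements-unique (_∙ a) (_∙ a ⁻¹) (∙-cancelʳ a) (∙-cancelʳ′ a) (λ _ → ∈-elements _) (λ _ → ∈-elements _)

-- The identity, the transpositions (01), (02), (12), and the cycles (012), (021).
app₃ : Fin 6 → Fin 3 → Fin 3
app₃ = lookup ∘ lookup
  ( (0F ∷ 1F ∷ 2F ∷ []) ∷ (1F ∷ 0F ∷ 2F ∷ []) ∷ (2F ∷ 1F ∷ 0F ∷ []) ∷ (0F ∷ 2F ∷ 1F ∷ [])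
  ∷ (1F ∷ 2F ∷ 0F ∷ []) ∷ (2F ∷ 0F ∷ 1F ∷ []) ∷ [])

inv₃ : Fin 6 → Fin 6
inv₃ = lookup (0F ∷ 1F ∷ 2F ∷ 3F ∷ 5F ∷ 4F ∷ [])

abstract
  app₃-inverse : ∀ a x → app₃ (inv₃ a) (app₃ a x) ≡ x × app₃ a (app₃ (inv₃ a) x) ≡ x
  app₃-inverse = from-yes (all? λ a → all? λ x → app₃ (inv₃ a) (app₃ a x) ≟ x ×-dec app₃ a (app₃ (inv₃ a) x) ≟ x)

  app₃-injective : ∀ a b → (∀ x → app₃ a x ≡ app₃ b x) → a ≡ b
  app₃-injective = from-yes (all? λ a → all? λ b → all? (λ x → app₃ a x ≟ app₃ b x) →-dec a ≟ b)

  compose₃ : ∀ a b → ∃ λ c → ∀ x → app₃ c x ≡ app₃ a (app₃ b x)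
  compose₃ = from-yes (all? λ a → all? λ b → any? λ c → all? λ x → app₃ c x ≟ app₃ a (app₃ b x))

module S₃ = PermutationTable app₃ inv₃ app₃-inverse app₃-injective compose₃

-- Listed by conjugacy class.
app₄ : Fin 24 → Fin 4 → Fin 4
app₄ = lookup ∘ lookup
  ( (0F ∷ 1F ∷ 2F ∷ 3F ∷ [])
  ∷ (0F ∷ 1F ∷ 3F ∷ 2F ∷ []) ∷ (0F ∷ 2F ∷ 1F ∷ 3F ∷ []) ∷ (0F ∷ 3F ∷ 2F ∷ 1F ∷ []) ∷ (1F ∷ 0F ∷ 2F ∷ 3F ∷ [])
  ∷ (2F ∷ 1F ∷ 0F ∷ 3F ∷ []) ∷ (3F ∷ 1F ∷ 2F ∷ 0F ∷ [])
  ∷ (1F ∷ 0F ∷ 3F ∷ 2F ∷ []) ∷ (2F ∷ 3F ∷ 0F ∷ 1F ∷ []) ∷ (3F ∷ 2F ∷ 1F ∷ 0F ∷ [])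
  ∷ (0F ∷ 2F ∷ 3F ∷ 1F ∷ []) ∷ (0F ∷ 3F ∷ 1F ∷ 2F ∷ []) ∷ (1F ∷ 2F ∷ 0F ∷ 3F ∷ []) ∷ (1F ∷ 3F ∷ 2F ∷ 0F ∷ [])
  ∷ (2F ∷ 0F ∷ 1F ∷ 3F ∷ []) ∷ (2F ∷ 1F ∷ 3F ∷ 0F ∷ []) ∷ (3F ∷ 0F ∷ 2F ∷ 1F ∷ []) ∷ (3F ∷ 1F ∷ 0F ∷ 2F ∷ [])
  ∷ (1F ∷ 2F ∷ 3F ∷ 0F ∷ []) ∷ (1F ∷ 3F ∷ 0F ∷ 2F ∷ []) ∷ (2F ∷ 0F ∷ 3F ∷ 1F ∷ []) ∷ (2F ∷ 3F ∷ 1F ∷ 0F ∷ [])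
  ∷ (3F ∷ 0F ∷ 1F ∷ 2F ∷ []) ∷ (3F ∷ 2F ∷ 0F ∷ 1F ∷ []) ∷ [])

inv₄ : Fin 24 → Fin 24
inv₄ = lookup
  ( # 0 ∷ # 1 ∷ # 2 ∷ # 3 ∷ # 4 ∷ # 5 ∷ # 6 ∷ # 7 ∷ # 8 ∷ # 9 ∷ # 11 ∷ # 10
  ∷ # 14 ∷ # 16 ∷ # 12 ∷ # 17 ∷ # 13 ∷ # 15 ∷ # 22 ∷ # 20 ∷ # 19 ∷ # 23 ∷ # 18 ∷ # 21 ∷ [])

abstract
  app₄-inverse : ∀ a x → app₄ (inv₄ a) (app₄ a x) ≡ x × app₄ a (app₄ (inv₄ a) x) ≡ x
  app₄-inverse = from-yes (all? λ a → all? λ x → app₄ (inv₄ a) (app₄ a x) ≟ x ×-dec app₄ a (app₄ (inv₄ a) x) ≟ x)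

  app₄-injective : ∀ a b → (∀ x → app₄ a x ≡ app₄ b x) → a ≡ b
  app₄-injective = from-yes (all? λ a → all? λ b → all? (λ x → app₄ a x ≟ app₄ b x) →-dec a ≟ b)

  compose₄ : ∀ a b → ∃ λ c → ∀ x → app₄ c x ≡ app₄ a (app₄ b x)
  compose₄ = from-yes (all? λ a → all? λ b → any? λ c → all? λ x → app₄ c x ≟ app₄ a (app₄ b x))

module S₄ = PermutationTable app₄ inv₄ app₄-inverse app₄-injective compose₄

-- The identity, a transposition, a product of two transpositions, a 3-cycle and a 4-cycle; each is
-- the first of its class in the table.
representative : Fin 5 → Fin 24
representative = lookup (# 0 ∷ # 1 ∷ # 7 ∷ # 10 ∷ # 18 ∷ [])

class : Fin 24 → Fin 5
class = lookup (0F ∷ replicate 6 1F Vec.++ replicate 3 2F Vec.++ replicate 8 3F Vec.++ replicate 6 4F)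

-- For each a, one of the possible k with a k = k r, where r represents the class of a;
-- `app₄-conjugator` checks the choice.
conjugator : Fin 24 → Fin 24
conjugator = lookup
  ( # 0 ∷ # 0 ∷ # 3 ∷ # 2 ∷ # 8 ∷ # 6 ∷ # 5 ∷ # 0 ∷ # 2 ∷ # 3 ∷ # 0 ∷ # 1
  ∷ # 6 ∷ # 8 ∷ # 9 ∷ # 4 ∷ # 5 ∷ # 7 ∷ # 0 ∷ # 1 ∷ # 4 ∷ # 2 ∷ # 3 ∷ # 6 ∷ [])

abstract
  app₄-conjugator : ∀ a x → app₄ a (app₄ (conjugator a) x) ≡ app₄ (conjugator a) (app₄ (representative (class a)) x)
  app₄-conjugator = from-yes (all? λ a → all? λ x →
    app₄ a (app₄ (conjugator a) x) ≟ app₄ (conjugator a) (app₄ (representative (class a)) x))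

class-size : Fin 5 → ℕ
class-size = lookup (1 ∷ 6 ∷ 3 ∷ 8 ∷ 6 ∷ [])

∑-class : ∀ (F : Fin 5 → ℕ) → ∑ S₄.elements (F ∘ class) ≡ ∑ (allFin 5) (λ t → class-size t * F t)
∑-class F = trans
  (∑-fibres _≟_ S₄.elements (Uniqueₚ.allFin⁺ 5) class (λ _ → ∈-allFin _) F)
  (∑-cong (allFin 5) (λ t → cong (_* F t)
    (trans (cong (λ as → ∑ as (λ a → ⟦ class a ≟ t ⟧)) S₄.elements-allFin) (size t))))
  where
  size : ∀ t → ∑ (allFin 24) (λ a → ⟦ class a ≟ t ⟧) ≡ class-size t
  size 0F = refl
  size 1F = refl
  size 2F = refl
  size 3F = refl
  size 4F = refl

⟨$⟩ʳ-injective : ∀ {n} (π : Permutation′ n) {i j} → π ⟨$⟩ʳ i ≡ π ⟨$⟩ʳ j → i ≡ j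
⟨$⟩ʳ-injective π eq = trans (sym (inverseˡ π)) (trans (cong (π ⟨$⟩ˡ_) eq) (inverseˡ π))

abstract
  -- Speaking of tuples of values instead of permutations makes this decidable by exhaustion.
  -- Injectivity rules out the repetitions, so the values of a permutation occur in the table.
  injective-in-table₃ : ∀ i j k → (i ≡ j ⊎ i ≡ k ⊎ j ≡ k) ⊎ ∃ λ a → app₃ a 0F ≡ i × app₃ a 1F ≡ j × app₃ a 2F ≡ k
  injective-in-table₃ = from-yes (all? λ i → all? λ j → all? λ k →
    (i ≟ j ⊎-dec i ≟ k ⊎-dec j ≟ k) ⊎-dec any? λ a → app₃ a 0F ≟ i ×-dec app₃ a 1F ≟ j ×-dec app₃ a 2F ≟ k)

abstract
  injective-in-table₄ : ∀ i j k l → (i ≡ j ⊎ i ≡ k ⊎ i ≡ l ⊎ j ≡ k ⊎ j ≡ l ⊎ k ≡ l) ⊎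
    ∃ λ a → app₄ a 0F ≡ i × app₄ a 1F ≡ j × app₄ a 2F ≡ k × app₄ a 3F ≡ l
  injective-in-table₄ = from-yes (all? λ i → all? λ j → all? λ k → all? λ l →
    (i ≟ j ⊎-dec i ≟ k ⊎-dec i ≟ l ⊎-dec j ≟ k ⊎-dec j ≟ l ⊎-dec k ≟ l) ⊎-dec
    any? λ a → app₄ a 0F ≟ i ×-dec app₄ a 1F ≟ j ×-dec app₄ a 2F ≟ k ×-dec app₄ a 3F ≟ l)

perm₃-surjective : ∀ π → ∃ λ a → S₃.perm a ≈ π
perm₃-surjective π with injective-in-table₃  (π ⟨$⟩ʳ 0F) (π ⟨$⟩ʳ 1F) (π ⟨$⟩ʳ 2F)
... | inj₁ (inj₁ eq)        = contradiction (⟨$⟩ʳ-injective π eq) λ ()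
... | inj₁ (inj₂ (inj₁ eq)) = contradiction (⟨$⟩ʳ-injective π eq) λ ()
... | inj₁ (inj₂ (inj₂ eq)) = contradiction (⟨$⟩ʳ-injective π eq) λ ()
... | inj₂ (a , p , q , r)  = a , λ { 0F → p ; 1F → q ; 2F → r }

perm₄-surjective : ∀ π → ∃ λ a → S₄.perm a ≈ π
perm₄-surjective π with injective-in-table₄  (π ⟨$⟩ʳ 0F) (π ⟨$⟩ʳ 1F) (π ⟨$⟩ʳ 2F) (π ⟨$⟩ʳ 3F)
... | inj₁ (inj₁ eq)                             = contradiction (⟨$⟩ʳ-injective π eq) λ ()
... | inj₁ (inj₂ (inj₁ eq))                      = contradiction (⟨$⟩ʳ-injective π eq) λ ()
... | inj₁ (inj₂ (inj₂ (inj₁ eq)))               = contradiction (⟨$⟩ʳ-injective π eq) λ ()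
... | inj₁ (inj₂ (inj₂ (inj₂ (inj₁ eq))))        = contradiction (⟨$⟩ʳ-injective π eq) λ ()
... | inj₁ (inj₂ (inj₂ (inj₂ (inj₂ (inj₁ eq))))) = contradiction (⟨$⟩ʳ-injective π eq) λ ()
... | inj₁ (inj₂ (inj₂ (inj₂ (inj₂ (inj₂ eq))))) = contradiction (⟨$⟩ʳ-injective π eq) λ ()
... | inj₂ (a , p , q , r , s)                   = a , λ { 0F → p ; 1F → q ; 2F → r ; 3F → s }

-- The action on subsets

Isotopy : Set
Isotopy = Fin 3 → Permutation′ 4

triple : {A : Set} → A → A → A → Fin 3 → A
triple i j k 0F = i
triple i j k 1F = j
triple i j k 2F = k

∈₃-cong : ∀ S {w w′ : Word} → w ≗ w′ → (w ∈₃ S) ≡ (w′ ∈₃ S)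
∈₃-cong S eq rewrite eq 0F | eq 1F | eq 2F = refl

triple-η : ∀ (w : Word) → triple (w 0F) (w 1F) (w 2F) ≗ w
triple-η w 0F = refl
triple-η w 1F = refl
triple-η w 2F = refl

tabulate³ : {A : Set} {l m n : ℕ} → (Fin l → Fin m → Fin n → A) → Vec (Vec (Vec A n) m) l
tabulate³ f = tabulate λ i → tabulate λ j → tabulate λ k → f i j k

lookup³ : {A : Set} {l m n : ℕ} → Vec (Vec (Vec A n) m) l → Fin l → Fin m → Fin n → A
lookup³ S i j k = lookup (lookup (lookup S i) j) k

lookup³∘tabulate³ : ∀ {A : Set} {l m n} (f : Fin l → Fin m → Fin n → A) i j k → lookup³ (tabulate³ f) i j k ≡ f i j k
lookup³∘tabulate³ f i j k = begin
  lookup³ (tabulate³ f) i j k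
    ≡⟨ cong (λ u → lookup (lookup u j) k) (lookup∘tabulate (λ i → tabulate λ j → tabulate λ k → f i j k) i) ⟩
  lookup (lookup (tabulate λ j → tabulate λ k → f i j k) j) k
    ≡⟨ cong (λ u → lookup u k) (lookup∘tabulate (λ j → tabulate λ k → f i j k) j) ⟩
  lookup (tabulate λ k → f i j k) k
    ≡⟨ lookup∘tabulate (f i j) k ⟩
  f i j k ∎
  where open ≡-Reasoning

lookup³-ext : ∀ {A : Set} {l m n} {S T : Vec (Vec (Vec A n) m) l} → (∀ i j k → lookup³ S i j k ≡ lookup³ T i j k) → S ≡ T
lookup³-ext eq = lookup-ext λ i → lookup-ext λ j → lookup-ext λ k → eq i j k
  where
  lookup-ext : ∀ {A : Set} {n} {u v : Vec A n} → (∀ i → lookup u i ≡ lookup v i) → u ≡ v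
  lookup-ext {u = u} {v} eq = trans (sym (tabulate∘lookup u)) (trans (tabulate-cong eq) (tabulate∘lookup v))

lookup³-map³ : ∀ {A B : Set} {l m n} (f : A → B) (S : Vec (Vec (Vec A n) m) l) i j k →
               lookup³ (Vec.map (Vec.map (Vec.map f)) S) i j k ≡ f (lookup³ S i j k)
lookup³-map³ f S i j k = begin
  lookup³ (Vec.map (Vec.map (Vec.map f)) S) i j k
    ≡⟨ cong (λ u → lookup (lookup u j) k) (lookup-map i (Vec.map (Vec.map f)) S) ⟩
  lookup (lookup (Vec.map (Vec.map f) (lookup S i)) j) k
    ≡⟨ cong (λ u → lookup u k) (lookup-map j (Vec.map f) (lookup S i)) ⟩
  lookup (Vec.map f (lookup (lookup S i) j)) k
    ≡⟨ lookup-map k f (lookup (lookup S i) j) ⟩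
  f (lookup³ S i j k) ∎
  where open ≡-Reasoning

∈₃-ext : ∀ {S T} → (∀ w → (w ∈₃ S) ≡ (w ∈₃ T)) → S ≡ T
∈₃-ext eq = lookup³-ext λ i j k → eq (triple i j k)

abstract
  subset : (Word → Bool) → Subset3
  subset f = tabulate³ λ i j k → f (triple i j k)

  ∈-subset : ∀ f → (∀ {w w′} → w ≗ w′ → f w ≡ f w′) → ∀ w → (w ∈₃ subset f) ≡ f w
  ∈-subset f f-cong w = trans (lookup³∘tabulate³ (λ i j k → f (triple i j k)) (w 0F) (w 1F) (w 2F)) (f-cong (triple-η w))

_≟₃_ : DecidableEquality Subset3
_≟₃_ = ≡-dec (≡-dec (≡-dec Bool._≟_))

∈-complement : ∀ S w → (w ∈₃ complement S) ≡ not (w ∈₃ S)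
∈-complement S w = lookup³-map³ not S (w 0F) (w 1F) (w 2F)

complement-involutive : ∀ S → complement (complement S) ≡ S
complement-involutive S = ∈₃-ext λ w →
  trans (∈-complement (complement S) w) (trans (cong not (∈-complement S w)) (not-involutive (w ∈₃ S)))

act-cong : ∀ σ θ {w w′} → w ≗ w′ → act σ θ w ≗ act σ θ w′
act-cong σ θ eq i = cong (θ (σ ⟨$⟩ˡ i) ⟨$⟩ʳ_) (eq (σ ⟨$⟩ˡ i))

⟨$⟩ˡ-cong : ∀ {n} {π ρ : Permutation′ n} → π ≈ ρ → ∀ i → π ⟨$⟩ˡ i ≡ ρ ⟨$⟩ˡ i
⟨$⟩ˡ-cong {π = π} {ρ} π≈ρ i = begin
  π ⟨$⟩ˡ i                       ≡⟨ inverseˡ ρ ⟨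
  ρ ⟨$⟩ˡ (ρ ⟨$⟩ʳ (π ⟨$⟩ˡ i))     ≡⟨ cong (ρ ⟨$⟩ˡ_) (π≈ρ (π ⟨$⟩ˡ i)) ⟨
  ρ ⟨$⟩ˡ (π ⟨$⟩ʳ (π ⟨$⟩ˡ i))     ≡⟨ cong (ρ ⟨$⟩ˡ_) (inverseʳ π) ⟩
  ρ ⟨$⟩ˡ i                       ∎
  where open ≡-Reasoning

act-≈ : ∀ σ σ′ θ θ′ → σ ≈ σ′ → (∀ j → θ j ≈ θ′ j) → ∀ w → act σ θ w ≗ act σ′ θ′ w
act-≈ σ σ′ θ θ′ σ≈ θ≈ w i =
  trans (θ≈ (σ ⟨$⟩ˡ i) _) (cong (λ j → θ′ j ⟨$⟩ʳ w j) (⟨$⟩ˡ-cong {π = σ} {σ′} σ≈ i))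

-- The multiplication of the wreath product: σ has already moved coordinate j to σ j when φ acts, so
-- j meets the entry of φ at σ j.
act-∘ : ∀ σ θ τ φ w → act τ φ (act σ θ w) ≗ act (σ ∘ₚ τ) (λ j → θ j ∘ₚ φ (σ ⟨$⟩ʳ j)) w
act-∘ σ θ τ φ w i = cong (λ l → φ l ⟨$⟩ʳ act σ θ w (τ ⟨$⟩ˡ i)) (sym (inverseʳ σ))

-- At i the inverse must undo the entry of θ at the coordinate that σ sends to i.
inverse-isotopy : Permutation′ 3 → Isotopy → Isotopy
inverse-isotopy σ θ i = flip (θ (σ ⟨$⟩ˡ i))

act-inverseʳ : ∀ σ θ w → act σ θ (act (flip σ) (inverse-isotopy σ θ) w) ≗ w
act-inverseʳ σ θ w i = along (inverseʳ σ)
  where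
  -- `l` stands for σ (σ⁻¹ i), which equals i only propositionally and occurs both in the
  -- permutation and in the argument of w.
  along : ∀ {l} → l ≡ i → θ (σ ⟨$⟩ˡ i) ⟨$⟩ʳ (θ (σ ⟨$⟩ˡ l) ⟨$⟩ˡ w l) ≡ w i
  along refl = inverseʳ (θ (σ ⟨$⟩ˡ i))

act-inverseˡ : ∀ σ θ w → act (flip σ) (inverse-isotopy σ θ) (act σ θ w) ≗ w
act-inverseˡ σ θ w i = trans (inverseˡ (θ (σ ⟨$⟩ˡ (σ ⟨$⟩ʳ i)))) (cong w (inverseˡ σ))

Equivalent-isEquivalence : IsEquivalence Equivalent
Equivalent-isEquivalence = record
  { refl  = Perm.id , (λ _ → Perm.id) , λ _ → refl
  ; sym   = λ { {S} {T} (σ , θ , eq) → flip σ , inverse-isotopy σ θ , λ w →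
                trans (sym (eq (act (flip σ) (inverse-isotopy σ θ) w))) (∈₃-cong T (act-inverseʳ σ θ w)) }
  ; trans = λ { {S} {T} {U} (σ , θ , eq) (τ , φ , eq′) → σ ∘ₚ τ , (λ j → θ j ∘ₚ φ (σ ⟨$⟩ʳ j)) , λ w →
                trans (sym (∈₃-cong U (act-∘ σ θ τ φ w))) (trans (eq′ (act σ θ w)) (eq w)) }
  }

abstract
  -- The preimage under `act σ θ`: membership then involves no inverse, and the group acts from the
  -- right.
  pull : Permutation′ 3 → Isotopy → Subset3 → Subset3
  pull σ θ S = subset (λ w → act σ θ w ∈₃ S)

  ∈-pull : ∀ σ θ S w → (w ∈₃ pull σ θ S) ≡ (act σ θ w ∈₃ S)
  ∈-pull σ θ S = ∈-subset (λ w → act σ θ w ∈₃ S) (λ eq → ∈₃-cong S (act-cong σ θ eq))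

pull-complement : ∀ σ θ S → pull σ θ (complement S) ≡ complement (pull σ θ S)
pull-complement σ θ S = ∈₃-ext λ w → begin
  w ∈₃ pull σ θ (complement S)    ≡⟨ ∈-pull σ θ (complement S) w ⟩
  act σ θ w ∈₃ complement S       ≡⟨ ∈-complement S (act σ θ w) ⟩
  not (act σ θ w ∈₃ S)            ≡⟨ cong not (∈-pull σ θ S w) ⟨
  not (w ∈₃ pull σ θ S)           ≡⟨ ∈-complement (pull σ θ S) w ⟨
  w ∈₃ complement (pull σ θ S)    ∎
  where open ≡-Reasoning

∈-pull² : ∀ σ θ τ φ S w → (w ∈₃ pull σ θ (pull τ φ S)) ≡ (act τ φ (act σ θ w) ∈₃ S)
∈-pull² σ θ τ φ S w = trans (∈-pull σ θ (pull τ φ S) w) (∈-pull τ φ S (act σ θ w))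

pull-inverseˡ : ∀ σ θ S → pull (flip σ) (inverse-isotopy σ θ) (pull σ θ S) ≡ S
pull-inverseˡ σ θ S = ∈₃-ext λ w → trans (∈-pull² (flip σ) (inverse-isotopy σ θ) σ θ S w) (∈₃-cong S (act-inverseʳ σ θ w))

pull-inverseʳ : ∀ σ θ S → pull σ θ (pull (flip σ) (inverse-isotopy σ θ) S) ≡ S
pull-inverseʳ σ θ S = ∈₃-ext λ w → trans (∈-pull² σ θ (flip σ) (inverse-isotopy σ θ) S w) (∈₃-cong S (act-inverseˡ σ θ w))

-- Invariance of unitrades under the action and under complementation

update-same : ∀ w j a → update w j a j ≡ a
update-same w j a with j ≟ j
... | yes _  = refl
... | no j≢j = contradiction refl j≢j

update-other : ∀ w j a {i} → i ≢ j → update w j a i ≡ w i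
update-other w j a {i} i≢j with i ≟ j
... | yes i≡j = contradiction i≡j i≢j
... | no _    = refl

-- The reason that lines go to lines: direction j turns into direction σ j, and `θ j` permutes the
-- points on the line.
act-update : ∀ σ θ w j a → act σ θ (update w j a) ≗ update (act σ θ w) (σ ⟨$⟩ʳ j) (θ j ⟨$⟩ʳ a)
act-update σ θ w j a i with i ≟ σ ⟨$⟩ʳ j
... | yes refl = along (inverseˡ σ)
  where
  along : ∀ {l} → l ≡ j → θ l ⟨$⟩ʳ update w j a l ≡ θ j ⟨$⟩ʳ a
  along refl = cong (θ j ⟨$⟩ʳ_) (update-same w j a)
... | no i≢σj  = cong (θ (σ ⟨$⟩ˡ i) ⟨$⟩ʳ_)
  (update-other w j a λ σ⁻¹i≡j → i≢σj (trans (sym (inverseʳ σ)) (cong (σ ⟨$⟩ʳ_) σ⁻¹i≡j)))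

-- As a sum over `allFin 4` the count can be reindexed by a permutation of the symbols.
count-∑ : ∀ f → count f ≡ ∑ (allFin 4) (λ a → if f a then 1 else 0)
count-∑ f with f 0F | f 1F | f 2F | f 3F
... | true  | true  | true  | true  = refl
... | true  | true  | true  | false = refl
... | true  | true  | false | true  = refl
... | true  | true  | false | false = refl
... | true  | false | true  | true  = refl
... | true  | false | true  | false = refl
... | true  | false | false | true  = refl
... | true  | false | false | false = refl
... | false | true  | true  | true  = refl
... | false | true  | true  | false = refl
... | false | true  | false | true  = refl
... | false | true  | false | false = refl
... | false | false | true  | true  = refl
... | false | false | true  | false = refl
... | false | false | false | true  = refl
... | false | false | false | false = refl

count-cong : ∀ {f g} → f ≗ g → count f ≡ count g
count-cong {f} {g} eq = trans (count-∑ f)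
  (trans (∑-cong (allFin 4) (λ a → cong (if_then 1 else 0) (eq a))) (sym (count-∑ g)))

count-permute : ∀ (π : Permutation′ 4) f → count (f ∘ (π ⟨$⟩ʳ_)) ≡ count f
count-permute π f = trans (count-∑ (f ∘ (π ⟨$⟩ʳ_))) (trans
  (∑-reindex _≟_ (Uniqueₚ.allFin⁺ 4) (π ⟨$⟩ʳ_) (π ⟨$⟩ˡ_) (λ _ → inverseˡ π) (λ _ → inverseʳ π)
    (λ _ → ∈-allFin _) (λ _ → ∈-allFin _) (λ a → if f a then 1 else 0))
  (sym (count-∑ f)))

pull-unitrade : ∀ σ θ {S} → IsUnitrade S → IsUnitrade (pull σ θ S)
pull-unitrade σ θ {S} u w j = subst (2 ∣_) (sym line) (u (act σ θ w) (σ ⟨$⟩ʳ j))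
  where
  open ≡-Reasoning
  line : count (λ a → update w j a ∈₃ pull σ θ S) ≡ count (λ a → update (act σ θ w) (σ ⟨$⟩ʳ j) a ∈₃ S)
  line = begin
    count (λ a → update w j a ∈₃ pull σ θ S)
      ≡⟨ count-cong (λ a → trans (∈-pull σ θ S (update w j a)) (∈₃-cong S (act-update σ θ w j a))) ⟩
    count (λ a → update (act σ θ w) (σ ⟨$⟩ʳ j) (θ j ⟨$⟩ʳ a) ∈₃ S)
      ≡⟨ count-permute (θ j) (λ a → update (act σ θ w) (σ ⟨$⟩ʳ j) a ∈₃ S) ⟩
    count (λ a → update (act σ θ w) (σ ⟨$⟩ʳ j) a ∈₃ S) ∎

parity : (Sym → Bool) → Bool
parity f = f 0F xor (f 1F xor (f 2F xor f 3F))

odd : ∀ {n} → ¬ (2 ∣ suc (n * 2))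
odd {n} (divides q eq) = go n q eq
  where
  go : ∀ n q → suc (n * 2) ≢ q * 2
  go (suc n) (suc q) eq = go n q (suc-injective (suc-injective eq))

-- The passage from divisibility to homogeneous equations over GF(2).
count-parity : ∀ f → (2 ∣ count f → parity f ≡ false) × (parity f ≡ false → 2 ∣ count f)
count-parity f with f 0F | f 1F | f 2F | f 3F
... | true  | true  | true  | true  = (λ _ → refl) , λ _ → divides 2 refl
... | true  | true  | true  | false = (λ e → contradiction e (odd {1})) , λ ()
... | true  | true  | false | true  = (λ e → contradiction e (odd {1})) , λ ()
... | true  | true  | false | false = (λ _ → refl) , λ _ → divides 1 refl
... | true  | false | true  | true  = (λ e → contradiction e (odd {1})) , λ ()
... | true  | false | true  | false = (λ _ → refl) , λ _ → divides 1 refl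
... | true  | false | false | true  = (λ _ → refl) , λ _ → divides 1 refl
... | true  | false | false | false = (λ e → contradiction e (odd {0})) , λ ()
... | false | true  | true  | true  = (λ e → contradiction e (odd {1})) , λ ()
... | false | true  | true  | false = (λ _ → refl) , λ _ → divides 1 refl
... | false | true  | false | true  = (λ _ → refl) , λ _ → divides 1 refl
... | false | true  | false | false = (λ e → contradiction e (odd {0})) , λ ()
... | false | false | true  | true  = (λ _ → refl) , λ _ → divides 1 refl
... | false | false | true  | false = (λ e → contradiction e (odd {0})) , λ ()
... | false | false | false | true  = (λ e → contradiction e (odd {0})) , λ ()
... | false | false | false | false = (λ _ → refl) , λ _ → divides 0 refl

-- All four cells of a line are flipped, an even number, so its parity is kept.
complement-unitrade : ∀ {S} → IsUnitrade S → IsUnitrade (complement S)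
complement-unitrade {S} u w j = proj₂ (count-parity (λ a → update w j a ∈₃ complement S))
  (trans (parity-not (λ a → ∈-complement S (update w j a))) (proj₁ (count-parity (λ a → update w j a ∈₃ S)) (u w j)))
  where
  parity-not : ∀ {f g} → (∀ a → f a ≡ not (g a)) → parity f ≡ parity g
  parity-not {f} {g} eq rewrite eq 0F | eq 1F | eq 2F | eq 3F with g 0F | g 1F | g 2F
  ... | true  | true  | true  = sym (not-involutive (not (g 3F)))
  ... | true  | true  | false = refl
  ... | true  | false | true  = refl
  ... | true  | false | false = not-involutive (not (g 3F))
  ... | false | true  | true  = refl
  ... | false | true  | false = not-involutive (not (g 3F))
  ... | false | false | true  = not-involutive (not (g 3F))
  ... | false | false | false = trans (not-involutive (not (not (g 3F)))) (not-involutive (g 3F))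

-- The finite group S₄ ≀ S₃ and its right action on subsets

G : Set
G = Fin 6 × Fin 24 × Fin 24 × Fin 24

abstract
  group-enumeration : Σ (List G) λ gs → (∀ g → g ∈ gs)
    × (∀ F → ∑ gs F ≡ ∑ S₃.elements λ σ → ∑ S₄.elements λ a → ∑ S₄.elements λ b → ∑ S₄.elements λ c → F (σ , a , b , c))
    × length gs ≡ 82944
  group-enumeration =
    let gs , ∈gs , ∑gs , length-gs = enumeration⁴ S₃.elements S₄.elements S₄.elements S₄.elements in
    gs , (λ (σ , a , b , c) → ∈gs (S₃.∈-elements σ) (S₄.∈-elements a) (S₄.∈-elements b) (S₄.∈-elements c)) , ∑gs ,
    trans length-gs (cong₂ (λ m n → m * (n * (n * n))) S₃.length-elements S₄.length-elements)

group : List G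
group = proj₁ group-enumeration

∈-group : ∀ g → g ∈ group
∈-group = proj₁ (proj₂ group-enumeration)

∑-group : ∀ F → ∑ group F ≡ ∑ S₃.elements λ σ → ∑ S₄.elements λ a → ∑ S₄.elements λ b → ∑ S₄.elements λ c → F (σ , a , b , c)
∑-group = proj₁ (proj₂ (proj₂ group-enumeration))

length-group : length group ≡ 82944
length-group = proj₂ (proj₂ (proj₂ group-enumeration))

infixl 7 _·_
_·_ : Subset3 → G → Subset3
S · (σ , a , b , c) = pull (S₃.perm σ) (S₄.perm ∘ triple a b c) S

·-Equivalent : ∀ S g → Equivalent (S · g) S
·-Equivalent S (σ , a , b , c) =
  S₃.perm σ , S₄.perm ∘ triple a b c , λ w → sym (∈-pull (S₃.perm σ) (S₄.perm ∘ triple a b c) S w)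

-- An equivalence from S to T presents S as a preimage of T, which fixes the direction; its
-- permutations are replaced by table entries with the same values.
Equivalent-· : ∀ {S T} → Equivalent S T → ∃ λ g → T · g ≡ S
Equivalent-· {S} {T} (σ , θ , eq) with perm₃-surjective σ
  | perm₄-surjective (θ 0F) | perm₄-surjective (θ 1F) | perm₄-surjective (θ 2F)
... | s , s≈σ | a , a≈ | b , b≈ | c , c≈ = (s , a , b , c) , ∈₃-ext λ w → begin
  w ∈₃ (T · (s , a , b , c))                           ≡⟨ ∈-pull (S₃.perm s) (S₄.perm ∘ triple a b c) T w ⟩
  act (S₃.perm s) (S₄.perm ∘ triple a b c) w ∈₃ T      ≡⟨ ∈₃-cong T (act-≈ (S₃.perm s) σ (S₄.perm ∘ triple a b c) θ s≈σ θ≈ w) ⟩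
  act σ θ w ∈₃ T                                       ≡⟨ eq w ⟩
  w ∈₃ S                                               ∎
  where
  open ≡-Reasoning
  θ≈ : ∀ j → S₄.perm (triple a b c j) ≈ θ j
  θ≈ 0F = a≈
  θ≈ 1F = b≈
  θ≈ 2F = c≈

-- A search through the opaque `group`, which is never run: the counts are reached by equational
-- reasoning.
Equivalent? : Decidable Equivalent
Equivalent? S T = map′ from to (Any.any? (λ g → (T · g) ≟₃ S) group)
  where
  from : Any (λ g → T · g ≡ S) group → Equivalent S T
  from p = let g , eq = Any.satisfied p in subst (λ U → Equivalent U T) eq (·-Equivalent T g)
  to : Equivalent S T → Any (λ g → T · g ≡ S) group
  to e = let g , eq = Equivalent-· {S} {T} e in lose (∈-group g) eq

infixl 7 _⋆_
-- Chosen to satisfy `·-⋆`. Pulling back along g and then along h means acting by h before g, so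
-- coordinate j meets the entry of g at `app₃ τ j`.
_⋆_ : G → G → G
(σ , a , b , c) ⋆ (τ , a′ , b′ , c′) = σ S₃.∙ τ , θ 0F S₄.∙ a′ , θ 1F S₄.∙ b′ , θ 2F S₄.∙ c′
  where
  θ : Fin 3 → Fin 24
  θ j = triple a b c (app₃ τ j)

·-⋆ : ∀ S g h → (S · g) · h ≡ S · (g ⋆ h)
·-⋆ S g@(σ , a , b , c) h@(τ , a′ , b′ , c′) = ∈₃-ext λ w → begin
  w ∈₃ ((S · g) · h)
    ≡⟨ ∈-pull² (S₃.perm τ) φ (S₃.perm σ) θ S w ⟩
  act (S₃.perm σ) θ (act (S₃.perm τ) φ w) ∈₃ S
    ≡⟨ ∈₃-cong S (act-∘ (S₃.perm τ) φ (S₃.perm σ) θ w) ⟩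
  act (S₃.perm τ ∘ₚ S₃.perm σ) (λ j → φ j ∘ₚ θ (app₃ τ j)) w ∈₃ S
    ≡⟨ ∈₃-cong S (act-≈ (S₃.perm τ ∘ₚ S₃.perm σ) (S₃.perm (σ S₃.∙ τ)) (λ j → φ j ∘ₚ θ (app₃ τ j)) ψ
         (λ i → sym (S₃.app-∙ σ τ i)) isotopy w) ⟩
  act (S₃.perm (σ S₃.∙ τ)) ψ w ∈₃ S
    ≡⟨ ∈-pull (S₃.perm (σ S₃.∙ τ)) ψ S w ⟨
  w ∈₃ (S · (g ⋆ h)) ∎
  where
  open ≡-Reasoning
  θ φ ψ : Isotopy
  θ = S₄.perm ∘ triple a b c
  φ = S₄.perm ∘ triple a′ b′ c′
  ψ = S₄.perm ∘ triple
    (triple a b c (app₃ τ 0F) S₄.∙ a′) (triple a b c (app₃ τ 1F) S₄.∙ b′) (triple a b c (app₃ τ 2F) S₄.∙ c′)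
  isotopy : ∀ j → (φ j ∘ₚ θ (app₃ τ j)) ≈ ψ j
  isotopy 0F x = sym (S₄.app-∙ (triple a b c (app₃ τ 0F)) a′ x)
  isotopy 1F x = sym (S₄.app-∙ (triple a b c (app₃ τ 1F)) b′ x)
  isotopy 2F x = sym (S₄.app-∙ (triple a b c (app₃ τ 2F)) c′ x)

-- Left translation is triangular: for fixed τ, each S₄ coordinate is itself left-translated by an
-- entry of g that depends on τ alone. Working outwards from the innermost sum leaves only
-- translations in S₄ and S₃.
∑-⋆ : ∀ g (F : G → ℕ) → ∑ group (λ h → F (g ⋆ h)) ≡ ∑ group F
∑-⋆ g@(σ , a , b , c) F = begin
  ∑ group (λ h → F (g ⋆ h))
    ≡⟨ ∑-group (λ h → F (g ⋆ h)) ⟩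
  (∑ S₃.elements λ τ → ∑ S₄.elements λ a′ → ∑ S₄.elements λ b′ → ∑ S₄.elements λ c′ →
    F (σ S₃.∙ τ , θ τ 0F S₄.∙ a′ , θ τ 1F S₄.∙ b′ , θ τ 2F S₄.∙ c′))
    ≡⟨ ∑-cong S₃.elements (λ τ → ∑-cong S₄.elements λ a′ → ∑-cong S₄.elements λ b′ →
         S₄.∑-∙ˡ (θ τ 2F) (λ c′ → F (σ S₃.∙ τ , θ τ 0F S₄.∙ a′ , θ τ 1F S₄.∙ b′ , c′))) ⟩
  (∑ S₃.elements λ τ → ∑ S₄.elements λ a′ → ∑ S₄.elements λ b′ → ∑ S₄.elements λ c′ →
    F (σ S₃.∙ τ , θ τ 0F S₄.∙ a′ , θ τ 1F S₄.∙ b′ , c′))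
    ≡⟨ ∑-cong S₃.elements (λ τ → ∑-cong S₄.elements λ a′ →
         S₄.∑-∙ˡ (θ τ 1F) (λ b′ → ∑ S₄.elements λ c′ → F (σ S₃.∙ τ , θ τ 0F S₄.∙ a′ , b′ , c′))) ⟩
  (∑ S₃.elements λ τ → ∑ S₄.elements λ a′ → ∑ S₄.elements λ b′ → ∑ S₄.elements λ c′ →
    F (σ S₃.∙ τ , θ τ 0F S₄.∙ a′ , b′ , c′))
    ≡⟨ ∑-cong S₃.elements (λ τ →
         S₄.∑-∙ˡ (θ τ 0F) (λ a′ → ∑ S₄.elements λ b′ → ∑ S₄.elements λ c′ → F (σ S₃.∙ τ , a′ , b′ , c′))) ⟩
  (∑ S₃.elements λ τ → ∑ S₄.elements λ a′ → ∑ S₄.elements λ b′ → ∑ S₄.elements λ c′ → F (σ S₃.∙ τ , a′ , b′ , c′))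
    ≡⟨ S₃.∑-∙ˡ σ (λ τ → ∑ S₄.elements λ a′ → ∑ S₄.elements λ b′ → ∑ S₄.elements λ c′ → F (τ , a′ , b′ , c′)) ⟩
  (∑ S₃.elements λ τ → ∑ S₄.elements λ a′ → ∑ S₄.elements λ b′ → ∑ S₄.elements λ c′ → F (τ , a′ , b′ , c′))
    ≡⟨ ∑-group F ⟨
  ∑ group F ∎
  where
  open ≡-Reasoning
  θ : Fin 6 → Fin 3 → Fin 24
  θ τ j = triple a b c (app₃ τ j)

-- If T · h = S, then S · g = T · (h ⋆ g), and `∑-⋆` absorbs the translation by h.
∑-transporters : ∀ {S T} → Equivalent S T → ∀ U → ∑ group (λ g → ⟦ (S · g) ≟₃ U ⟧) ≡ ∑ group (λ g → ⟦ (T · g) ≟₃ U ⟧)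
∑-transporters {S} {T} e U =
  let h , T·h≡S = Equivalent-· {S} {T} e in
  trans (∑-cong group (λ g → cong (λ V → ⟦ V ≟₃ U ⟧) (trans (cong (_· g) (sym T·h≡S)) (·-⋆ T h g))))
        (∑-⋆ h (λ g → ⟦ (T · g) ≟₃ U ⟧))

-- Unitrades as solutions of a linear system

index : Word → Fin 64
index w = combine (w 0F) (combine (w 1F) (w 2F))

index-cong : ∀ {w w′} → w ≗ w′ → index w ≡ index w′
index-cong eq = cong₂ combine (eq 0F) (cong₂ combine (eq 1F) (eq 2F))

unindex : Fin 64 → Word
unindex p = let i , q = remQuot {4} 16 p ; j , k = remQuot {4} 4 q in triple i j k

index-unindex : ∀ p → index (unindex p) ≡ p
index-unindex p = let i , q = remQuot {4} 16 p in
  trans (cong (combine i) (combine-remQuot {4} 4 q)) (combine-remQuot {4} 16 p)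

fromVec : Vec Bool 64 → Subset3
fromVec v = subset (λ w → lookup v (index w))

∈-fromVec : ∀ v w → (w ∈₃ fromVec v) ≡ lookup v (index w)
∈-fromVec v = ∈-subset (λ w → lookup v (index w)) (λ eq → cong (lookup v) (index-cong eq))

toVec : Subset3 → Vec Bool 64
toVec S = tabulate (λ p → unindex p ∈₃ S)

unindex-index : ∀ w → unindex (index w) ≗ w
unindex-index w 0F = cong proj₁ (remQuot-combine {4} {16} (w 0F) (combine (w 1F) (w 2F)))
unindex-index w 1F = trans
  (cong (λ q → proj₁ (remQuot {4} 4 (proj₂ q))) (remQuot-combine {4} {16} (w 0F) (combine (w 1F) (w 2F))))
  (cong proj₁ (remQuot-combine {4} {4} (w 1F) (w 2F)))
unindex-index w 2F = trans
  (cong (λ q → proj₂ (remQuot {4} 4 (proj₂ q))) (remQuot-combine {4} {16} (w 0F) (combine (w 1F) (w 2F))))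
  (cong proj₂ (remQuot-combine {4} {4} (w 1F) (w 2F)))

fromVec-toVec : ∀ S → fromVec (toVec S) ≡ S
fromVec-toVec S = ∈₃-ext λ w → trans (∈-fromVec (toVec S) w)
  (trans (lookup∘tabulate (λ p → unindex p ∈₃ S) (index w)) (∈₃-cong S (unindex-index w)))

fromVec-injective : ∀ {u v} → fromVec u ≡ fromVec v → u ≡ v
fromVec-injective {u} {v} eq = trans (sym (tabulate∘lookup u)) (trans (tabulate-cong agree) (tabulate∘lookup v))
  where
  open ≡-Reasoning
  agree : ∀ p → lookup u p ≡ lookup v p
  agree p = begin
    lookup u p                       ≡⟨ cong (lookup u) (index-unindex p) ⟨
    lookup u (index (unindex p))     ≡⟨ ∈-fromVec u (unindex p) ⟨
    unindex p ∈₃ fromVec u           ≡⟨ cong (unindex p ∈₃_) eq ⟩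
    unindex p ∈₃ fromVec v           ≡⟨ ∈-fromVec v (unindex p) ⟩
    lookup v (index (unindex p))     ≡⟨ cong (lookup v) (index-unindex p) ⟩
    lookup v p                       ∎

cell : Word → Vec Bool 64
cell w = unit (index w)

eval-cell : ∀ w v → eval (cell w) v ≡ (w ∈₃ fromVec v)
eval-cell w v = trans (eval-unit (index w) v) (sym (∈-fromVec v w))

lineForm : (Sym → Word) → Vec Bool 64
lineForm l = cell (l 0F) ⊕ (cell (l 1F) ⊕ (cell (l 2F) ⊕ cell (l 3F)))

eval-lineForm : ∀ l v → eval (lineForm l) v ≡ parity (λ a → l a ∈₃ fromVec v)
eval-lineForm l v =
  trans (eval-⊕ (cell (l 0F)) _ v) (cong₂ _xor_ (eval-cell (l 0F) v)
  (trans (eval-⊕ (cell (l 1F)) _ v) (cong₂ _xor_ (eval-cell (l 1F) v)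
  (trans (eval-⊕ (cell (l 2F)) _ v) (cong₂ _xor_ (eval-cell (l 2F) v) (eval-cell (l 3F) v))))))

-- `IsUnitrade` names a line by any of its four points; a direction and the two remaining
-- coordinates name each of the 48 lines once.
line : Fin 3 → Sym × Sym → Sym → Word
line 0F (i , j) a = triple a i j
line 1F (i , j) a = triple i a j
line 2F (i , j) a = triple i j a

lineEqn : Sym × Sym × Fin 3 → Eqn 64
lineEqn (i , j , d) = lineForm (line d (i , j)) , false

lines : List (Sym × Sym × Fin 3)
lines = cartesianProduct (allFin 4) (cartesianProduct (allFin 4) (allFin 3))

lineEqns : List (Eqn 64)
lineEqns = map lineEqn lines

transversal : Fin 3 → Word → Sym × Sym
transversal 0F w = w 1F , w 2F
transversal 1F w = w 0F , w 2F
transversal 2F w = w 0F , w 1F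

update-line : ∀ w d a → update w d a ≗ line d (transversal d w) a
update-line w 0F a 0F = refl
update-line w 0F a 1F = refl
update-line w 0F a 2F = refl
update-line w 1F a 0F = refl
update-line w 1F a 1F = refl
update-line w 1F a 2F = refl
update-line w 2F a 0F = refl
update-line w 2F a 1F = refl
update-line w 2F a 2F = refl

transversal-line : ∀ d ij a → transversal d (line d ij a) ≡ ij
transversal-line 0F ij a = refl
transversal-line 1F ij a = refl
transversal-line 2F ij a = refl

count-line : ∀ S w d → count (λ a → update w d a ∈₃ S) ≡ count (λ a → line d (transversal d w) a ∈₃ S)
count-line S w d = count-cong (λ a → ∈₃-cong S (update-line w d a))

lineEqns-sound : ∀ v → All (Solves v) lineEqns → IsUnitrade (fromVec v)
lineEqns-sound v solves w d = subst (2 ∣_) (sym (count-line (fromVec v) w d))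
  (proj₂ (count-parity (λ a → line d (transversal d w) a ∈₃ fromVec v))
    (trans (sym (eval-lineForm (line d (transversal d w)) v))
      (All.lookup (Allₚ.map⁻ {xs = lines} {f = lineEqn} solves)
        (∈-cartesianProduct⁺ (∈-allFin _) (∈-cartesianProduct⁺ (∈-allFin _) (∈-allFin d))))))

lineEqns-complete : ∀ v → IsUnitrade (fromVec v) → All (Solves v) lineEqns
lineEqns-complete v u = Allₚ.map⁺ {xs = lines} {f = lineEqn} (All.universal solves lines)
  where
  solves : ∀ l → Solves v (lineEqn l)
  solves (i , j , d) = trans (eval-lineForm (line d (i , j)) v)
    (proj₁ (count-parity (λ a → line d (i , j) a ∈₃ fromVec v))
      (subst (2 ∣_) (trans (count-line (fromVec v) (line d (i , j) 0F) d)
        (cong (λ kl → count (λ a → line d kl a ∈₃ fromVec v)) (transversal-line d (i , j) 0F))) (u (line d (i , j) 0F) d)))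

-- By `∈-twist` this is xor with a constant, so invariant sets and sets sent to their complement
-- satisfy equations with the same left-hand sides.
twist : Bool → Subset3 → Subset3
twist c S = if c then complement S else S

∈-twist : ∀ c S w → (w ∈₃ twist c S) ≡ c xor (w ∈₃ S)
∈-twist true  S w = ∈-complement S w
∈-twist false S w = refl

fixEqn : Permutation′ 3 → Isotopy → Bool → Sym × Sym × Sym → Eqn 64
fixEqn σ θ c (i , j , k) = cell (triple i j k) ⊕ cell (act σ θ (triple i j k)) , c

words : List (Sym × Sym × Sym)
words = cartesianProduct (allFin 4) (cartesianProduct (allFin 4) (allFin 4))

fixEqns : Permutation′ 3 → Isotopy → Bool → List (Eqn 64)
fixEqns σ θ c = map (fixEqn σ θ c) words

xor-solve⁺ : ∀ x y {c} → x xor y ≡ c → y ≡ c xor x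
xor-solve⁺ false false refl = refl
xor-solve⁺ false true  refl = refl
xor-solve⁺ true  false refl = refl
xor-solve⁺ true  true  refl = refl

xor-solve⁻ : ∀ x c {y} → y ≡ c xor x → x xor y ≡ c
xor-solve⁻ false false refl = refl
xor-solve⁻ false true  refl = refl
xor-solve⁻ true  false refl = refl
xor-solve⁻ true  true  refl = refl

module _ (σ : Permutation′ 3) (θ : Isotopy) (c : Bool) (v : Vec Bool 64) where
  private
    S : Subset3
    S = fromVec v

  eval-fixEqn : ∀ i j k → eval (proj₁ (fixEqn σ θ c (i , j , k))) v ≡ (triple i j k ∈₃ S) xor (triple i j k ∈₃ pull σ θ S)
  eval-fixEqn i j k = begin
    eval (cell w ⊕ cell (act σ θ w)) v           ≡⟨ eval-⊕ (cell w) (cell (act σ θ w)) v ⟩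
    eval (cell w) v xor eval (cell (act σ θ w)) v ≡⟨ cong₂ _xor_ (eval-cell w v) (eval-cell (act σ θ w) v) ⟩
    (w ∈₃ S) xor (act σ θ w ∈₃ S)                ≡⟨ cong ((w ∈₃ S) xor_) (∈-pull σ θ S w) ⟨
    (w ∈₃ S) xor (w ∈₃ pull σ θ S)               ∎
    where
    open ≡-Reasoning
    w = triple i j k

  fixEqns-sound : All (Solves v) (fixEqns σ θ c) → pull σ θ S ≡ twist c S
  fixEqns-sound solves = ∈₃-ext λ w → begin
    w ∈₃ pull σ θ S                              ≡⟨ ∈₃-cong (pull σ θ S) (triple-η w) ⟨
    triple (w 0F) (w 1F) (w 2F) ∈₃ pull σ θ S    ≡⟨ xor-solve⁺
      (triple (w 0F) (w 1F) (w 2F) ∈₃ S) (triple (w 0F) (w 1F) (w 2F) ∈₃ pull σ θ S)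
      (trans (sym (eval-fixEqn (w 0F) (w 1F) (w 2F)))
        (All.lookup (Allₚ.map⁻ {xs = words} {f = fixEqn σ θ c} solves)
          (∈-cartesianProduct⁺ (∈-allFin (w 0F)) (∈-cartesianProduct⁺ (∈-allFin (w 1F)) (∈-allFin (w 2F)))))) ⟩
    c xor (triple (w 0F) (w 1F) (w 2F) ∈₃ S)     ≡⟨ cong (c xor_) (∈₃-cong S (triple-η w)) ⟩
    c xor (w ∈₃ S)                               ≡⟨ ∈-twist c S w ⟨
    w ∈₃ twist c S                               ∎
    where open ≡-Reasoning

  fixEqns-complete : pull σ θ S ≡ twist c S → All (Solves v) (fixEqns σ θ c)
  fixEqns-complete eq = Allₚ.map⁺ {xs = words} {f = fixEqn σ θ c} (All.universal solves words)
    where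
    solves : ∀ w → Solves v (fixEqn σ θ c w)
    solves (i , j , k) = trans (eval-fixEqn i j k)
      (xor-solve⁻ (w ∈₃ S) c (trans (cong (w ∈₃_) eq) (∈-twist c S w)))
      where
      w : Word
      w = triple i j k

-- Abstract, so that conversion checking never unfolds the list of 2 ^ 27 elements.
abstract
  unitrade-enumeration : Σ (List Subset3) λ L → Unique L
    × (∀ v → All (Solves v) lineEqns → fromVec v ∈ L)
    × (∀ {S} → S ∈ L → ∃ λ v → All (Solves v) lineEqns × S ≡ fromVec v)
    × (∀ {P : Subset3 → Set} (P? : ∀ S → Dec (P S)) es →
        (∀ v → All (Solves v) es → P (fromVec v)) → (∀ v → P (fromVec v) → All (Solves v) es) →
        ∑ L (λ S → ⟦ P? S ⟧) ≡ #solutions 64 (lineEqns ++ es))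
  unitrade-enumeration = solution-enumeration lineEqns fromVec fromVec-injective

unitrades : List Subset3
unitrades = proj₁ unitrade-enumeration

unitrades-unique : Unique unitrades
unitrades-unique = proj₁ (proj₂ unitrade-enumeration)

∈-unitrades⁺ : ∀ {S} → IsUnitrade S → S ∈ unitrades
∈-unitrades⁺ {S} u = subst (_∈ unitrades) (fromVec-toVec S) (proj₁ (proj₂ (proj₂ unitrade-enumeration)) (toVec S)
  (lineEqns-complete (toVec S) (subst IsUnitrade (sym (fromVec-toVec S)) u)))

∈-unitrades⁻ : ∀ {S} → S ∈ unitrades → IsUnitrade S
∈-unitrades⁻ S∈ with proj₁ (proj₂ (proj₂ (proj₂ unitrade-enumeration))) S∈
... | v , solves , refl = lineEqns-sound v solves

∑-unitrades : {P : Subset3 → Set} (P? : ∀ S → Dec (P S)) (es : List (Eqn 64)) →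
              (∀ v → All (Solves v) es → P (fromVec v)) → (∀ v → P (fromVec v) → All (Solves v) es) →
              ∑ unitrades (λ S → ⟦ P? S ⟧) ≡ #solutions 64 (lineEqns ++ es)
∑-unitrades = proj₂ (proj₂ (proj₂ (proj₂ unitrade-enumeration)))

#fixed : Permutation′ 3 → Isotopy → Bool → ℕ
#fixed σ θ c = ∑ unitrades (λ S → ⟦ pull σ θ S ≟₃ twist c S ⟧)

#fixed-solutions : ∀ σ θ c → #fixed σ θ c ≡ #solutions 64 (lineEqns ++ fixEqns σ θ c)
#fixed-solutions σ θ c =
  ∑-unitrades (λ S → pull σ θ S ≟₃ twist c S) (fixEqns σ θ c) (fixEqns-sound σ θ c) (fixEqns-complete σ θ c)

-- Fixed-point counts

pull-twist : ∀ σ θ c S → pull σ θ (twist c S) ≡ twist c (pull σ θ S)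
pull-twist σ θ true  S = pull-complement σ θ S
pull-twist σ θ false S = refl

pull-∈-unitrades : ∀ σ θ {S} → S ∈ unitrades → pull σ θ S ∈ unitrades
pull-∈-unitrades σ θ {S} S∈ = ∈-unitrades⁺ (pull-unitrade σ θ {S} (∈-unitrades⁻ S∈))

-- Pulling back along h turns the sets fixed by g into those fixed by h⁻¹ g h.
#fixed-conjugate : ∀ σ θ σ′ θ′ τ h c → (∀ w → act τ h (act σ′ θ′ w) ≗ act σ θ (act τ h w)) →
                   #fixed σ θ c ≡ #fixed σ′ θ′ c
#fixed-conjugate σ θ σ′ θ′ τ h c intertwines = sym (begin
  ∑ unitrades (λ S → ⟦ pull σ′ θ′ S ≟₃ twist c S ⟧)
    ≡⟨ ∑-reindex _≟₃_ unitrades-unique H H⁻¹ (pull-inverseˡ τ h) (pull-inverseʳ τ h)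
         (pull-∈-unitrades τ h) (pull-∈-unitrades (flip τ) (inverse-isotopy τ h))
         (λ S → ⟦ pull σ′ θ′ S ≟₃ twist c S ⟧) ⟨
  ∑ unitrades (λ S → ⟦ pull σ′ θ′ (H S) ≟₃ twist c (H S) ⟧)
    ≡⟨ ∑-cong unitrades (λ S → ⟦⟧-cong (pull σ′ θ′ (H S) ≟₃ twist c (H S)) (pull σ θ S ≟₃ twist c S)
         (λ eq → begin
           pull σ θ S                 ≡⟨ pull-inverseˡ τ h (pull σ θ S) ⟨
           H⁻¹ (H (pull σ θ S))       ≡⟨ cong H⁻¹ (commutes S) ⟨
           H⁻¹ (pull σ′ θ′ (H S))     ≡⟨ cong H⁻¹ eq ⟩
           H⁻¹ (twist c (H S))        ≡⟨ cong H⁻¹ (pull-twist τ h c S) ⟨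
           H⁻¹ (H (twist c S))        ≡⟨ pull-inverseˡ τ h (twist c S) ⟩
           twist c S                  ∎)
         (λ eq → trans (commutes S) (trans (cong H eq) (pull-twist τ h c S)))) ⟩
  ∑ unitrades (λ S → ⟦ pull σ θ S ≟₃ twist c S ⟧) ∎)
  where
  open ≡-Reasoning
  H H⁻¹ : Subset3 → Subset3
  H   = pull τ h
  H⁻¹ = pull (flip τ) (inverse-isotopy τ h)

  commutes : ∀ S → pull σ′ θ′ (H S) ≡ H (pull σ θ S)
  commutes S = ∈₃-ext λ w → begin
    w ∈₃ pull σ′ θ′ (H S)              ≡⟨ ∈-pull² σ′ θ′ τ h S w ⟩
    act τ h (act σ′ θ′ w) ∈₃ S         ≡⟨ ∈₃-cong S (intertwines w) ⟩
    act σ θ (act τ h w) ∈₃ S           ≡⟨ ∈-pull² τ h σ θ S w ⟨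
    w ∈₃ H (pull σ θ S)                ∎

#fix : Bool → Fin 6 → Fin 24 → Fin 24 → Fin 24 → ℕ
#fix c σ a b d = #fixed (S₃.perm σ) (S₄.perm ∘ triple a b d) c

-- Conjugating by an isotopy keeps σ. Once the target entries are prescribed, h at one coordinate
-- determines h at the next along a cycle of σ.
#fix-conjugate : ∀ c σ a b d a′ b′ d′ (h : Fin 3 → Fin 24) →
  (∀ j x → app₄ (triple a b d j) (app₄ (h j) x) ≡ app₄ (h (app₃ σ j)) (app₄ (triple a′ b′ d′ j) x)) →
  #fix c σ a b d ≡ #fix c σ a′ b′ d′
#fix-conjugate c σ a b d a′ b′ d′ h intertwines =
  #fixed-conjugate (S₃.perm σ) (S₄.perm ∘ triple a b d) (S₃.perm σ) (S₄.perm ∘ triple a′ b′ d′) Perm.id (S₄.perm ∘ h) c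
    λ w i → let j = S₃.perm σ ⟨$⟩ˡ i in
      sym (trans (intertwines j (w j))
        (cong (λ l → app₄ (h l) (app₄ (triple a′ b′ d′ j) (w j))) (inverseʳ (S₃.perm σ))))

ρ : Fin 24 → Fin 24
ρ a = representative (class a)

open S₄ using (_∙_; app-∙)

-- The step along a cycle: if h is k here and `a ∙ k` at the next coordinate, the entry a turns into
-- the identity, `0F` in the table.
conjugate-step : ∀ a k x → app₄ a (app₄ k x) ≡ app₄ (a ∙ k) (app₄ 0F x)
conjugate-step a k x = trans (sym (app-∙ a k x)) (cong (app₄ (a ∙ k)) (sym (app₄-0 x)))
  where
  app₄-0 : ∀ x → app₄ 0F x ≡ x
  app₄-0 0F = refl
  app₄-0 1F = refl
  app₄-0 2F = refl
  app₄-0 3F = refl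

-- The end of a 2-cycle: back at the start, the accumulated product `b ∙ a` must be conjugated to
-- its representative, which dictates the initial h.
conjugate-close : ∀ b a x → app₄ b (app₄ (a ∙ conjugator (b ∙ a)) x) ≡ app₄ (conjugator (b ∙ a)) (app₄ (ρ (b ∙ a)) x)
conjugate-close b a x = trans (cong (app₄ b) (app-∙ a k x)) (trans (sym (app-∙ b a (app₄ k x))) (app₄-conjugator (b ∙ a) x))
  where
  k : Fin 24
  k = conjugator (b ∙ a)

conjugate-close³ : ∀ d b a x → app₄ d (app₄ (b ∙ (a ∙ conjugator (d ∙ (b ∙ a)))) x) ≡
                   app₄ (conjugator (d ∙ (b ∙ a))) (app₄ (ρ (d ∙ (b ∙ a))) x)
conjugate-close³ d b a x = trans
  (cong (app₄ d) (trans (app-∙ b (a ∙ k) x) (trans (cong (app₄ b) (app-∙ a k x))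
    (trans (sym (app-∙ b a (app₄ k x))) (sym (app-∙ (b ∙ a) k x))))))
  (conjugate-close d (b ∙ a) x)
  where
  k : Fin 24
  k = conjugator (d ∙ (b ∙ a))

module _ (c : Bool) (a b d : Fin 24) where

  #fix-id : #fix c 0F a b d ≡ #fix c 0F (ρ a) (ρ b) (ρ d)
  #fix-id = #fix-conjugate c 0F a b d _ _ _ (triple (conjugator a) (conjugator b) (conjugator d)) λ where
    0F → app₄-conjugator a
    1F → app₄-conjugator b
    2F → app₄-conjugator d

  #fix-01 : #fix c 1F a b d ≡ #fix c 1F 0F (ρ (b ∙ a)) (ρ d)
  #fix-01 = #fix-conjugate c 1F a b d _ _ _ (triple k (a ∙ k) (conjugator d)) λ where
      0F → conjugate-step a k
      1F → conjugate-close b a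
      2F → app₄-conjugator d
    where
    k : Fin 24
    k = conjugator (b ∙ a)

  #fix-012 : #fix c 4F a b d ≡ #fix c 4F 0F 0F (ρ (d ∙ (b ∙ a)))
  #fix-012 = #fix-conjugate c 4F a b d _ _ _ (triple k (a ∙ k) (b ∙ (a ∙ k))) λ where
      0F → conjugate-step a k
      1F → conjugate-step b (a ∙ k)
      2F → conjugate-close³ d b a
    where
    k : Fin 24
    k = conjugator (d ∙ (b ∙ a))

  -- The elements over (02), (12) and (021) are carried to ones over (01), (02) and (012)
  -- by a transposition of coordinates.
  #fix-02 : #fix c 2F a b d ≡ #fix c 1F a d b
  #fix-02 = #fixed-conjugate (S₃.perm 2F) (S₄.perm ∘ triple a b d) (S₃.perm 1F) (S₄.perm ∘ triple a d b)
    (S₃.perm 3F) (λ _ → Perm.id) c λ w → λ { 0F → refl ; 1F → refl ; 2F → refl }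

  #fix-12 : #fix c 3F a b d ≡ #fix c 2F b a d
  #fix-12 = #fixed-conjugate (S₃.perm 3F) (S₄.perm ∘ triple a b d) (S₃.perm 2F) (S₄.perm ∘ triple b a d)
    (S₃.perm 1F) (λ _ → Perm.id) c λ w → λ { 0F → refl ; 1F → refl ; 2F → refl }

  #fix-021 : #fix c 5F a b d ≡ #fix c 4F b a d
  #fix-021 = #fixed-conjugate (S₃.perm 5F) (S₄.perm ∘ triple a b d) (S₃.perm 4F) (S₄.perm ∘ triple b a d)
    (S₃.perm 1F) (λ _ → Perm.id) c λ w → λ { 0F → refl ; 1F → refl ; 2F → refl }

-- Summation of the fixed-point counts over the group

classSum : (Fin 5 → ℕ) → ℕ
classSum f = ∑ (allFin 5) (λ t → class-size t * f t)

∑₄ : (Fin 24 → ℕ) → ℕ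
∑₄ = ∑ S₄.elements

∑₄-cong : ∀ {f g : Fin 24 → ℕ} → f ≗ g → ∑₄ f ≡ ∑₄ g
∑₄-cong = ∑-cong S₄.elements

∑₄-const : ∀ n → ∑₄ (λ _ → n) ≡ 24 * n
∑₄-const n = trans (∑-const S₄.elements n) (cong (_* n) S₄.length-elements)

∑₄² : ∀ (F : Fin 5 → Fin 5 → ℕ) → ∑₄ (λ a → ∑₄ λ b → F (class a) (class b)) ≡ classSum λ t → classSum λ u → F t u
∑₄² F = trans (∑₄-cong λ a → ∑-class (F (class a))) (∑-class λ t → classSum (F t))

∑₄³ : ∀ (F : Fin 5 → Fin 5 → Fin 5 → ℕ) →
      ∑₄ (λ a → ∑₄ λ b → ∑₄ λ d → F (class a) (class b) (class d)) ≡ classSum λ t → classSum λ u → classSum λ v → F t u v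
∑₄³ F = trans (∑₄-cong λ a → ∑₄² (F (class a))) (∑-class λ t → classSum λ u → classSum λ v → F t u v)

-- For fixed a, b ↦ b ∙ a permutes S₄, so each of the 24 values of a contributes the same class sum.
∑₄-swap : ∀ (F : Fin 5 → Fin 5 → ℕ) →
          ∑₄ (λ a → ∑₄ λ b → ∑₄ λ d → F (class (b ∙ a)) (class d)) ≡ 24 * classSum λ t → classSum λ u → F t u
∑₄-swap F = trans (∑₄-cong λ a → trans (S₄.∑-∙ʳ a (λ b → ∑₄ λ d → F (class b) (class d))) (∑₄² F))
                  (∑₄-const (classSum λ t → classSum λ u → F t u))

-- For each of the 24 · 24 pairs a, b the product runs once through S₄ as d does.
∑₄-cycle : ∀ (F : Fin 5 → ℕ) →
           ∑₄ (λ a → ∑₄ λ b → ∑₄ λ d → F (class (d ∙ (b ∙ a)))) ≡ 24 * (24 * classSum F)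
∑₄-cycle F = trans
  (∑₄-cong λ a → trans (∑₄-cong λ b → trans (S₄.∑-∙ʳ (b ∙ a) (F ∘ class)) (∑-class F)) (∑₄-const (classSum F)))
  (∑₄-const (24 * classSum F))

abstract
  -- Opaque while sums are rearranged, so that no elimination starts early; it unfolds in the
  -- abstract block that evaluates the class sums.
  #sol : Bool → Fin 6 → Fin 5 → Fin 5 → Fin 5 → ℕ
  #sol c σ t u v = #solutions 64
    (lineEqns ++ fixEqns (S₃.perm σ) (S₄.perm ∘ triple (representative t) (representative u) (representative v)) c)

  #fix-#sol : ∀ c σ t u v → #fix c σ (representative t) (representative u) (representative v) ≡ #sol c σ t u v
  #fix-#sol c σ t u v =
    #fixed-solutions (S₃.perm σ) (S₄.perm ∘ triple (representative t) (representative u) (representative v)) c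

#fixes : Bool → Fin 6 → ℕ
#fixes c σ = ∑₄ λ a → ∑₄ λ b → ∑₄ λ d → #fix c σ a b d

module _ (c : Bool) where

  #fixes-id : #fixes c 0F ≡ classSum λ t → classSum λ u → classSum λ v → #sol c 0F t u v
  #fixes-id = trans
    (∑₄-cong λ a → ∑₄-cong λ b → ∑₄-cong λ d → trans (#fix-id c a b d) (#fix-#sol c 0F (class a) (class b) (class d)))
    (∑₄³ (#sol c 0F))

  #fixes-01 : #fixes c 1F ≡ 24 * classSum λ t → classSum λ u → #sol c 1F 0F t u
  #fixes-01 = trans
    (∑₄-cong λ a → ∑₄-cong λ b → ∑₄-cong λ d → trans (#fix-01 c a b d) (#fix-#sol c 1F 0F (class (b ∙ a)) (class d)))
    (∑₄-swap (#sol c 1F 0F))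

  #fixes-012 : #fixes c 4F ≡ 24 * (24 * classSum λ t → #sol c 4F 0F 0F t)
  #fixes-012 = trans
    (∑₄-cong λ a → ∑₄-cong λ b → ∑₄-cong λ d → trans (#fix-012 c a b d) (#fix-#sol c 4F 0F 0F (class (d ∙ (b ∙ a)))))
    (∑₄-cycle (#sol c 4F 0F 0F))

  #fixes-02 : #fixes c 2F ≡ #fixes c 1F
  #fixes-02 = trans (∑₄-cong λ a → ∑₄-cong λ b → ∑₄-cong λ d → #fix-02 c a b d)
    (∑₄-cong λ a → ∑-swap S₄.elements S₄.elements (λ b d → #fix c 1F a d b))

  #fixes-12 : #fixes c 3F ≡ #fixes c 2F
  #fixes-12 = trans (∑₄-cong λ a → ∑₄-cong λ b → ∑₄-cong λ d → #fix-12 c a b d)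
    (∑-swap S₄.elements S₄.elements (λ a b → ∑₄ λ d → #fix c 2F b a d))

  #fixes-021 : #fixes c 5F ≡ #fixes c 4F
  #fixes-021 = trans (∑₄-cong λ a → ∑₄-cong λ b → ∑₄-cong λ d → #fix-021 c a b d)
    (∑-swap S₄.elements S₄.elements (λ a b → ∑₄ λ d → #fix c 4F b a d))

abstract
  -- By computation: each `refl` runs 125 eliminations, one per triple of cycle types, on 48 line
  -- equations and 64 equations for the group element. The totals are the fixed-point counts summed
  -- over all 24³ isotopies.
  #sol-id : ∀ c → (classSum λ t → classSum λ u → classSum λ v → #sol c 0F t u v) ≡ (if c then 16561152 else 163067904)
  #sol-id true  = refl
  #sol-id false = refl

  #sol-01 : ∀ c → (classSum λ t → classSum λ u → #sol c 1F 0F t u) ≡ (if c then 125568 else 603648)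
  #sol-01 true  = refl
  #sol-01 false = refl

  #sol-012 : ∀ c → (classSum λ t → #sol c 4F 0F 0F t) ≡ (if c then 240 else 2736)
  #sol-012 true  = refl
  #sol-012 false = refl

∑-#fix : ∀ c → ∑ group (λ g → ∑ unitrades (λ S → ⟦ (S · g) ≟₃ twist c S ⟧)) ≡ (if c then 82944 * 312 else 82944 * 2528)
∑-#fix c = begin
  ∑ group (λ g → ∑ unitrades (λ S → ⟦ (S · g) ≟₃ twist c S ⟧))
    ≡⟨ ∑-group (λ g → ∑ unitrades (λ S → ⟦ (S · g) ≟₃ twist c S ⟧)) ⟩
  ∑ S₃.elements (#fixes c)
    ≡⟨ cong (λ σs → ∑ σs (#fixes c)) S₃.elements-allFin ⟩
  #fixes c 0F + (#fixes c 1F + (#fixes c 2F + (#fixes c 3F + (#fixes c 4F + (#fixes c 5F + 0)))))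
    ≡⟨ cong₂ _+_ id (cong₂ _+_ swap (cong₂ _+_ (trans (#fixes-02 c) swap)
         (cong₂ _+_ (trans (#fixes-12 c) (trans (#fixes-02 c) swap))
           (cong₂ _+_ cycle (cong (_+ 0) (trans (#fixes-021 c) cycle)))))) ⟩
  total (if c then 16561152 else 163067904) (if c then 125568 else 603648) (if c then 240 else 2736)
    ≡⟨ evaluate c ⟩
  (if c then 82944 * 312 else 82944 * 2528) ∎
  where
  open ≡-Reasoning
  -- Besides the identity, S₃ has three transpositions, contributing `24 * s` each, and two
  -- 3-cycles, contributing `24 * (24 * r)` each.
  total : ℕ → ℕ → ℕ → ℕ
  total i s r = i + (24 * s + (24 * s + (24 * s + (24 * (24 * r) + (24 * (24 * r) + 0)))))

  id : #fixes c 0F ≡ (if c then 16561152 else 163067904)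
  id = trans (#fixes-id c) (#sol-id c)

  swap : #fixes c 1F ≡ 24 * (if c then 125568 else 603648)
  swap = trans (#fixes-01 c) (cong (24 *_) (#sol-01 c))

  cycle : #fixes c 4F ≡ 24 * (24 * (if c then 240 else 2736))
  cycle = trans (#fixes-012 c) (cong (λ n → 24 * (24 * n)) (#sol-012 c))

  evaluate : ∀ c → total (if c then 16561152 else 163067904) (if c then 125568 else 603648) (if c then 240 else 2736)
                 ≡ (if c then 82944 * 312 else 82944 * 2528)
  evaluate true  = refl
  evaluate false = refl

-- Representatives

representatives : List Subset3
representatives = deduplicate Equivalent? unitrades

representatives-⊆ : ∀ {S} → S ∈ representatives → S ∈ unitrades
representatives-⊆ = Anyₚ.deduplicate⁻ Equivalent?

representatives-separated : AllPairs (λ S T → ¬ Equivalent S T) representatives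
representatives-separated = DecUniqueₚ.deduplicate-! Equivalent-decSetoid unitrades
  where
  Equivalent-decSetoid : DecSetoid _ _
  Equivalent-decSetoid = record
    { isDecEquivalence = record { isEquivalence = Equivalent-isEquivalence ; _≟_ = Equivalent? } }

representatives-complete : ∀ {S} → S ∈ unitrades → Any (Equivalent S) representatives
representatives-complete {S} S∈ = Anyₚ.deduplicate⁺ Equivalent?
  (λ {T} {U} U~T S~T → E.trans {S} {T} {U} S~T (E.sym {U} {T} U~T)) (lose S∈ (E.refl {S}))
  where module E = IsEquivalence Equivalent-isEquivalence

twist-involutive : ∀ c S → twist c (twist c S) ≡ S
twist-involutive true  = complement-involutive
twist-involutive false S = refl

twist-∈-unitrades : ∀ c {S} → S ∈ unitrades → twist c S ∈ unitrades
twist-∈-unitrades true  {S} S∈ = ∈-unitrades⁺ (complement-unitrade {S} (∈-unitrades⁻ S∈))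
twist-∈-unitrades false S∈ = S∈

twist-· : ∀ c S g → twist c S · g ≡ twist c (S · g)
twist-· c S (σ , a , b , d) = pull-twist (S₃.perm σ) (S₄.perm ∘ triple a b d) c S

·-∈-unitrades : ∀ {S} g → S ∈ unitrades → S · g ∈ unitrades
·-∈-unitrades (σ , a , b , d) = pull-∈-unitrades (S₃.perm σ) (S₄.perm ∘ triple a b d)

-- The group order 82944 is cancelled from the orbit count. For `c` = false all representatives are
-- counted, for true those equivalent to their complement.
∑-representatives-twist : ∀ c → ∑ representatives (λ S → ⟦ Equivalent? S (twist c S) ⟧) ≡ (if c then 312 else 2528)
∑-representatives-twist c = *-cancelˡ-≡ _ _ 82944 (begin
  82944 * ∑ representatives (λ S → ⟦ Equivalent? S (twist c S) ⟧)
    ≡⟨ cong (_* ∑ representatives (λ S → ⟦ Equivalent? S (twist c S) ⟧)) length-group ⟨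
  length group * ∑ representatives (λ S → ⟦ Equivalent? S (twist c S) ⟧)
    ≡⟨ Burnside.twisted-burnside _≟₃_ unitrades-unique group _·_ Equivalent? Equivalent-isEquivalence
         ·-∈-unitrades ·-Equivalent (λ {S} {T} → ∑-transporters {S} {T})
         representatives-⊆ representatives-separated representatives-complete
         (twist c) (twist-involutive c) (twist-∈-unitrades c) (twist-· c) ⟨
  ∑ group (λ g → ∑ unitrades (λ S → ⟦ (S · g) ≟₃ twist c S ⟧))
    ≡⟨ ∑-#fix c ⟩
  (if c then 82944 * 312 else 82944 * 2528)
    ≡⟨ distribute c ⟩
  82944 * (if c then 312 else 2528) ∎)
  where
  open ≡-Reasoning
  distribute : ∀ c → (if c then 82944 * 312 else 82944 * 2528) ≡ 82944 * (if c then 312 else 2528)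
  distribute true  = refl
  distribute false = refl

length-representatives : length representatives ≡ 2528
length-representatives = begin
  length representatives                                           ≡⟨ *-identityʳ _ ⟨
  length representatives * 1                                       ≡⟨ ∑-const representatives 1 ⟨
  ∑ representatives (λ _ → 1)
    ≡⟨ ∑-cong representatives (λ S → ⟦⟧-yes (Equivalent? S S) (E.refl {S})) ⟨
  ∑ representatives (λ S → ⟦ Equivalent? S S ⟧)                    ≡⟨ ∑-representatives-twist false ⟩
  2528                                                             ∎
  where
  open ≡-Reasoning
  module E = IsEquivalence Equivalent-isEquivalence

length-unitrades : length unitrades ≡ 2 ^ 27
length-unitrades = begin
  length unitrades                     ≡⟨ *-identityʳ _ ⟨
  length unitrades * 1                 ≡⟨ ∑-const unitrades 1 ⟨
  ∑ unitrades (λ _ → 1)       ≡⟨ ∑-unitrades {λ _ → ⊤} (λ _ → yes tt) [] (λ _ _ → tt) (λ _ _ → []) ⟩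
  -- The exponent is 3³, since a unitrade is determined by its arbitrary values on a 3 × 3 × 3
  -- subcube; here the number comes from evaluating the elimination.
  #solutions 64 (lineEqns ++ [])       ≡⟨⟩
  2 ^ 27                               ∎
  where open ≡-Reasoning

-- Splitting the representatives by self-complementarity

selfComplementary? : ∀ S → Dec (Equivalent S (complement S))
selfComplementary? S = Equivalent? S (complement S)

-- Complementation commutes with the action, so this is a property of the class and not of the
-- chosen representative.
selfComplementary-resp : ∀ {S T} → Equivalent S T → Equivalent S (complement S) → Equivalent T (complement T)
selfComplementary-resp {S} {T} S~T@(σ , θ , eq) S~S̄ =
  E.trans {T} {S} {complement T} (E.sym {S} {T} S~T) (E.trans {S} {complement S} {complement T} S~S̄ S̄~T̄)
  where
  module E = IsEquivalence Equivalent-isEquivalence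
  S̄~T̄ : Equivalent (complement S) (complement T)
  S̄~T̄ = σ , θ , λ w → trans (∈-complement T (act σ θ w)) (trans (cong not (eq w)) (sym (∈-complement S w)))

selfReps otherReps : List Subset3
selfReps = filter selfComplementary? representatives
otherReps = filter (¬? ∘ selfComplementary?) representatives

∈-split : ∀ {S} → S ∈ representatives → S ∈ selfReps ++ otherReps
∈-split {S} S∈ = case (selfComplementary? S)
  where
  case : Dec (Equivalent S (complement S)) → S ∈ selfReps ++ otherReps
  case (yes p) = ∈-++⁺ˡ (∈-filter⁺ selfComplementary? S∈ p)
  case (no ¬p) = ∈-++⁺ʳ selfReps (∈-filter⁺ (¬? ∘ selfComplementary?) S∈ ¬p)

split-unitrades : All IsUnitrade (selfReps ++ otherReps)
split-unitrades = Allₚ.++⁺ (Allₚ.filter⁺ selfComplementary? all) (Allₚ.filter⁺ (¬? ∘ selfComplementary?) all)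
  where
  all : All IsUnitrade representatives
  all = All.tabulate (λ S∈ → ∈-unitrades⁻ (representatives-⊆ S∈))

-- Within each part separation is inherited; across the parts an equivalence would carry
-- self-complementarity from the first to the second.
split-separated : AllPairs (λ S T → ¬ Equivalent S T) (selfReps ++ otherReps)
split-separated = AllPairsₚ.++⁺
  (AllPairsₚ.filter⁺ selfComplementary? representatives-separated)
  (AllPairsₚ.filter⁺ (¬? ∘ selfComplementary?) representatives-separated)
  (All.map (λ {S} s → All.map (λ {T} ¬t S~T → ¬t (selfComplementary-resp {S} {T} S~T s))
    (Allₚ.all-filter (¬? ∘ selfComplementary?) representatives)) (Allₚ.all-filter selfComplementary? representatives))

split-complete : ∀ S → IsUnitrade S → Any (Equivalent S) (selfReps ++ otherReps)
split-complete S u = let T , T∈ , S~T = find (representatives-complete (∈-unitrades⁺ {S} u)) in lose (∈-split T∈) S~T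

length-split : length (selfReps ++ otherReps) ≡ 2528
length-split = begin
  length (selfReps ++ otherReps)
    ≡⟨ length-++ selfReps ⟩
  length selfReps + length otherReps
    ≡⟨ cong₂ _+_ (length-filter selfComplementary? representatives) (length-filter (¬? ∘ selfComplementary?) representatives) ⟩
  ∑ representatives (λ S → ⟦ selfComplementary? S ⟧) + ∑ representatives (λ S → ⟦ ¬? (selfComplementary? S) ⟧)
    ≡⟨ ∑-+ representatives (λ S → ⟦ selfComplementary? S ⟧) (λ S → ⟦ ¬? (selfComplementary? S) ⟧) ⟨
  ∑ representatives (λ S → ⟦ selfComplementary? S ⟧ + ⟦ ¬? (selfComplementary? S) ⟧)
    ≡⟨ ∑-cong representatives (λ S → ⟦⟧-¬ (selfComplementary? S)) ⟩
  ∑ representatives (λ _ → 1)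
    ≡⟨ ∑-const representatives 1 ⟩
  length representatives * 1
    ≡⟨ *-identityʳ _ ⟩
  length representatives
    ≡⟨ length-representatives ⟩
  2528 ∎
  where open ≡-Reasoning

theorem3 : (Σ (List Subset3) λ L →
    All IsUnitrade L × Unique L × (∀ S → IsUnitrade S → S ∈ L) × length L ≡ 2 ^ 27)
    × (Σ (List Subset3) λ R₁ → Σ (List Subset3) λ R₂ →
    All IsUnitrade (R₁ ++ R₂)
    × AllPairs (λ S T → ¬ Equivalent S T) (R₁ ++ R₂)
    × (∀ S → IsUnitrade S → Any (Equivalent S) (R₁ ++ R₂))
    × length (R₁ ++ R₂) ≡ 2528
    × All (λ S → Equivalent S (complement S)) R₁
    × All (λ S → ¬ Equivalent S (complement S)) R₂
    × length R₁ ≡ 312)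
theorem3 =
  (unitrades , All.tabulate ∈-unitrades⁻ , unitrades-unique , (λ S → ∈-unitrades⁺ {S}) , length-unitrades) ,
  (selfReps , otherReps , split-unitrades , split-separated , split-complete , length-split ,
   Allₚ.all-filter selfComplementary? representatives ,
   Allₚ.all-filter (¬? ∘ selfComplementary?) representatives ,
   trans (length-filter selfComplementary? representatives) (∑-representatives-twist true))
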